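{- Let $n\ge m\ge1$ and let $A$ be a complex $m\times n$ matrix. If $1\le p\le q$, then $$\|A\|_{S_p}^p\le\sigma_1^p(A)+(m-1)^{1-p/q}\left(\|A\|_{S_q}^q-\sigma_1^q(A)\right)^{p/q}.$$ Equality in this inequality is possible if and only if $\sigma_2(A)=\cdots=\sigma_m(A)$.
   Context: For an $m\times n$ complex matrix $A$, $\sigma_1(A)\ge\cdots\ge\sigma_m(A)$ are its singular values (square roots of the eigenvalues of $AA^*$, where $A^*$ is the Hermitian adjoint of $A$), and for real $p\ge1$, $\|A\|_{S_p}=\left(\sigma_1^p(A)+\cdots+\sigma_m^p(A)\right)^{1/p}$ is the Schatten $p$-norm.
   Formalization: The "only if" part of the equality statement is proved for p < q only; for p = q the inequality is always an equality (e.g. p = q = 1, A = diag(3,2,1)), so equality does not force σ_2 = ... = σ_m there. -}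

module Defs where

open import Algebra.Bundles using (CommutativeRing; Semiring)
open import Algebra.Bundles.Raw using (RawRing)
open import Algebra.Core using (Op₁; Op₂)
import Algebra.Definitions.RawSemiring as RawSemiringDefs
open import Algebra.Structures using (IsCommutativeRing)
open import Data.Bool.Base using (if_then_else_)
open import Data.Fin.Base as Fin using (Fin; zero; suc; toℕ; punchIn)
import Data.Fin.Properties as Fin
open import Data.Nat.Base as ℕ using (ℕ; zero; suc)
open import Data.Product.Base using (_×_; ∃-syntax)
open import Level using (0ℓ) renaming (suc to lsuc)
open import Relation.Binary.Core using (Rel)
import Relation.Binary.Construct.NonStrictToStrict as ToStrict
open import Relation.Binary.Structures using (IsDecTotalOrder)
open import Relation.Nullary.Decidable.Core using (does)
open import Relation.Nullary.Negation.Core using (¬_)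
open import Relation.Unary using (Pred; Satisfiable)

------------------------------------------------------------------------
-- The real numbers, axiomatised as a Dedekind-complete ordered field.
--
-- These axioms determine ℝ up to isomorphism.  The order is decidable, as
-- in classical mathematics; excluded middle for Set gives a model.
-- The values 0# ⁻¹ and sup P for P empty or unbounded are left unspecified.

record CompleteOrderedField : Set (lsuc 0ℓ) where
  infix  9 _⁻¹
  infix  8 -_
  infixl 7 _*_
  infixl 6 _+_
  infix  4 _≈_ _≤_
  field
    Carrier : Set
    _≈_     : Rel Carrier 0ℓ
    _≤_     : Rel Carrier 0ℓ
    _+_     : Op₂ Carrier
    _*_     : Op₂ Carrier
    -_      : Op₁ Carrier
    _⁻¹     : Op₁ Carrier
    0#      : Carrier
    1#      : Carrier

    isCommutativeRing : IsCommutativeRing _≈_ _+_ _*_ -_ 0# 1#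
    0≉1               : ¬ (0# ≈ 1#)
    *-inverseʳ        : ∀ x → ¬ (x ≈ 0#) → x * x ⁻¹ ≈ 1#

    isDecTotalOrder   : IsDecTotalOrder _≈_ _≤_
    +-monoˡ-≤         : ∀ {x y} z → x ≤ y → x + z ≤ y + z
    *-nonNegative     : ∀ {x y} → 0# ≤ x → 0# ≤ y → 0# ≤ x * y

  UpperBound : Pred Carrier 0ℓ → Pred Carrier 0ℓ
  UpperBound P u = ∀ x → P x → x ≤ u

  field
    sup       : Pred Carrier 0ℓ → Carrier
    sup-upper : ∀ P → Satisfiable P → Satisfiable (UpperBound P) →
                UpperBound P (sup P)
    sup-least : ∀ P → Satisfiable P → ∀ u → UpperBound P u → sup P ≤ u

  commutativeRing : CommutativeRing 0ℓ 0ℓ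
  commutativeRing = record { isCommutativeRing = isCommutativeRing }

  open IsDecTotalOrder isDecTotalOrder public using (_≟_; _≤?_)
  open ToStrict _≈_ _≤_ public using (_<_)

------------------------------------------------------------------------

Matrix : Set → ℕ → ℕ → Set
Matrix A m n = Fin m → Fin n → A

module _ (R : RawRing 0ℓ 0ℓ) where
  open RawRing R
  open RawSemiringDefs rawSemiring using (_^_; sum)

  -- Laplace expansion along the first row.
  det : ∀ {n} → Matrix Carrier n n → Carrier
  det {zero}  M = 1#
  det {suc n} M = sum λ j →
    (- 1#) ^ toℕ j * M zero j * det (λ k l → M (suc k) (punchIn j l))

  -- The value det (t I - M) of the characteristic polynomial of M at t.
  charPoly : ∀ {n} → Matrix Carrier n n → Carrier → Carrier
  charPoly M t = det λ i j →
    (if does (i Fin.≟ j) then t else 0#) + - M i j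

------------------------------------------------------------------------

module RealAnalysis (ℝ : CompleteOrderedField) where
  open CompleteOrderedField ℝ public
  open CommutativeRing commutativeRing public using (_-_; semiring)
  open RawSemiringDefs (Semiring.rawSemiring semiring) public using (_^_; sum)
    renaming (_×_ to _·_)

  infixl 7 _/_
  _/_ : Op₂ Carrier
  x / y = x * y ⁻¹

  fromℕ : ℕ → Carrier
  fromℕ n = n · 1#

  -- The powers x ^ r with r = (a - c) / b rational and r ≤ p (for x > 0):
  -- y = x ^ r is the positive solution of y ^ b * x ^ c = x ^ a.
  RationalPowersBelow : Carrier → Carrier → Pred Carrier 0ℓ
  RationalPowersBelow x p y =
    0# < y × ∃[ a ] ∃[ b ] ∃[ c ]
      (0 ℕ.< b × fromℕ a - fromℕ c ≤ p * fromℕ b ×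
       y ^ b * x ^ c ≈ x ^ a)

  -- Real powers of nonnegative reals: for x ≥ 1, x ^ʳ p is the supremum of
  -- x ^ r over rational r ≤ p; for 0 < x < 1 it is 1 / (1 / x) ^ʳ p.
  -- Conventions: 0 ^ʳ 0 = 1 and 0 ^ʳ p = 0 for p > 0.  The values for x < 0
  -- (or x = 0 and p < 0) carry no meaning.
  infixr 8 _^ʳ_
  _^ʳ_ : Op₂ Carrier
  x ^ʳ p =
    if does (x ≤? 0#) then (if does (p ≟ 0#) then 1# else 0#)
    else if does (1# ≤? x) then sup (RationalPowersBelow x p)
    else sup (RationalPowersBelow (x ⁻¹) p) ⁻¹

  ----------------------------------------------------------------------
  -- Complex numbers

  infix 5 _+i_
  record Complex : Set where
    constructor _+i_
    field
      re im : Carrier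
  open Complex public

  ℂ : RawRing 0ℓ 0ℓ
  ℂ = record
    { Carrier = Complex
    ; _≈_     = λ z w → re z ≈ re w × im z ≈ im w
    ; _+_     = λ z w → (re z + re w) +i (im z + im w)
    ; _*_     = λ z w → (re z * re w - im z * im w) +i
                        (re z * im w + im z * re w)
    ; -_      = λ z → (- re z) +i (- im z)
    ; 0#      = 0# +i 0#
    ; 1#      = 1# +i 0#
    }

  private
    module ℂ where
      open RawRing ℂ public
      open RawSemiringDefs (RawRing.rawSemiring ℂ) public using (sum; product)

  fromReal : Carrier → Complex
  fromReal x = x +i 0#

  conj : Complex → Complex
  conj z = re z +i (- im z)

  adjoint : ∀ {m n} → Matrix Complex m n → Matrix Complex n m
  adjoint A i j = conj (A j i)

  infixl 7 _⊛_
  _⊛_ : ∀ {l m n} →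
        Matrix Complex l m → Matrix Complex m n → Matrix Complex l n
  (A ⊛ B) i k = ℂ.sum λ j → A i j ℂ.* B j k

  ----------------------------------------------------------------------
  -- Singular values and Schatten norms

  -- μ lists the eigenvalues of M with (algebraic) multiplicity:
  -- det (t I - M) = ∏ᵢ (t - μᵢ) for all t.
  AreEigenvalues : ∀ {m} → Matrix Complex m m → (Fin m → Complex) → Set
  AreEigenvalues M μ =
    ∀ t → charPoly ℂ M t ℂ.≈ ℂ.product (λ i → t ℂ.+ (ℂ.- μ i))

  -- σ₁ ≥ ⋯ ≥ σₘ are the singular values of A; the index of σ₁ is zero.
  record AreSingularValues {m n} (A : Matrix Complex m n)
                           (σ : Fin m → Carrier) : Set where
    field
      nonNegative   : ∀ i → 0# ≤ σ i
      nonIncreasing : ∀ {i j} → i Fin.≤ j → σ j ≤ σ i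
      eigenvalues   : AreEigenvalues (A ⊛ adjoint A)
                                     (λ i → fromReal (σ i ^ 2))

  -- ‖A‖ in the Schatten p-norm, for A with singular values σ.
  schattenNorm : ∀ {m} → Carrier → (Fin m → Carrier) → Carrier
  schattenNorm p σ = (sum λ i → σ i ^ʳ p) ^ʳ (1# / p)

module Submission where

-- The matrix enters only through σᵢ ≥ 0. With aᵢ = σᵢ ^ q for i ≥ 2, k = m - 1 and r = p / q ≤ 1, the claim is the
-- power mean inequality Σ aᵢ ^ r ≤ k ^ (1 - r) (Σ aᵢ) ^ r. For M = (Σ aᵢ) / k it is the sum over i of
-- aᵢ ^ r M ^ (1 - r) ≤ r aᵢ + (1 - r) M, where equality forces aᵢ = M if r < 1. The latter follows from
-- log t ≤ t - 1, with equality only at t = 1.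
--
-- The logarithm is built without roots: log x is the supremum of n (1 - w) over n ≥ 1 and w > 0 with w ^ (-n) ≤ x.
-- Bernoulli's inequality gives 1 - 1 / x ≤ log x ≤ x - 1 and additivity, hence an inverse exp; the powers x ^ʳ p are
-- then identified by log (x ^ʳ p) = p log x.

open import Defs
open import Algebra.Bundles using (CommutativeRing; Semiring)
import Algebra.Definitions.RawSemiring as RawSemiringDefs
import Algebra.Properties.CommutativeSemiring.Exp as Exp
import Algebra.Properties.Monoid.Mult.TCOptimised as TCOptimised
import Algebra.Properties.Ring as RingProperties
import Algebra.Properties.Semiring.Mult as Mult
import Algebra.Properties.Semiring.Sum as Sum
import Algebra.Solver.Ring as RingSolver
open import Algebra.Solver.Ring.AlmostCommutativeRing using (fromCommutativeRing; _-Raw-AlmostCommutative⟶_)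
open import Data.Fin.Base using (Fin; zero; suc; toℕ; fromℕ<)
open import Data.Integer.Base as ℤ using (ℤ; +_; -[1+_]; _⊖_)
import Data.Integer.Properties as ℤ
import Data.Maybe.Base as Maybe
open import Data.Nat.Base as ℕ using (ℕ; zero; suc; _∸_)
import Data.Nat.Properties as ℕ
open import Data.Product.Base using (_×_; _,_; proj₁; proj₂; ∃-syntax)
open import Data.Sum.Base using (_⊎_; inj₁; inj₂; [_,_]′)
open import Function.Base using (_∘_)
open import Level using (0ℓ)
open import Relation.Binary.Bundles using (Poset)
import Relation.Binary.Construct.NonStrictToStrict as ToStrict
import Relation.Binary.PropositionalEquality.Core as ≡
import Relation.Binary.Reasoning.PartialOrder as PosetReasoning
import Relation.Binary.Reasoning.Setoid as SetoidReasoning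
open import Relation.Binary.Structures using (IsDecTotalOrder)
open import Relation.Nullary.Decidable.Core using (yes; no; decidable-stable; dec⇒maybe)
open import Relation.Nullary.Negation.Core using (¬_; contradiction)
open import Relation.Unary using (Pred; Satisfiable; Decidable)

-- A real power is defined as a supremum of rational powers, and a rational power is only given by
-- an equation between natural powers. Exponent laws proved on that definition would require
-- constructing roots and then a limit argument for each law. A logarithm defined by natural powers
-- alone avoids this: it is a supremum of explicit linear expressions, and once `exp` inverts it,
-- roots come for free and each exponent law becomes a linear identity. The price is the base 0,
-- which has no logarithm and gets its own case throughout. The logic is constructive apart from the
-- decidable order. Hence the Archimedean property yields no actual natural number, only the
-- absurdity of there being none. Inequalities are decidable and therefore stable, so such a number
-- may still be chosen inside the proof of any inequality.

module RealPowers (ℝ : CompleteOrderedField) where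
  open RealAnalysis ℝ
  open CommutativeRing commutativeRing
    using ( refl; sym; trans; setoid; ring; +-cong; +-congˡ; +-congʳ; *-cong; *-congˡ; *-congʳ; -‿cong
          ; +-identityˡ; +-identityʳ; *-identityˡ; *-identityʳ; +-comm; *-comm; *-assoc; +-assoc
          ; zeroˡ; zeroʳ; distribˡ; commutativeSemiring; -‿inverseʳ)
  open IsDecTotalOrder isDecTotalOrder
    using (antisym; total; isPartialOrder)
    renaming (reflexive to ≤-reflexive; trans to ≤-trans; refl to ≤-refl)
  open Mult semiring using (×-homo-+; ×1-homo-*)
  open Sum semiring using (*-distribʳ-sum; sum-cong-≋)
  open Exp commutativeSemiring using (^-congˡ; ^-assocʳ; ^-homo-*; ^-distrib-*)

  poset : Poset _ _ _
  poset = record { isPartialOrder = isPartialOrder }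

  -- Ring solver with integer coefficients

  module Solver where
    open RingProperties ring using (-‿distribˡ-*; -‿distribʳ-*; -‿involutive; -0#≈0#; -‿+-comm)
    open SetoidReasoning setoid
    open RawSemiringDefs (Semiring.rawSemiring semiring) using (_×′_)
    module TC = TCOptimised (CommutativeRing.+-monoid commutativeRing)

    -- With _×′_ the term con (+ 1) of the solver denotes 1# itself, not 1# + 0#.
    fromℤ : ℤ → Carrier
    fromℤ (+ n)    = n ×′ 1#
    fromℤ -[1+ n ] = - (suc n ×′ 1#)

    fromℕ≈ : ∀ n → n ×′ 1# ≈ fromℕ n
    fromℕ≈ n = sym (TC.×ᵤ≈× n 1#)

    fromℤ-neg : ∀ n → fromℤ (ℤ.- (+ n)) ≈ - fromℕ n
    fromℤ-neg zero    = sym -0#≈0#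
    fromℤ-neg (suc n) = -‿cong (fromℕ≈ (suc n))

    fromℤ-⊖ : ∀ m n → fromℤ (m ⊖ n) ≈ fromℕ m - fromℕ n
    fromℤ-⊖ m zero = trans (fromℕ≈ m) (sym (trans (+-congˡ -0#≈0#) (+-identityʳ _)))
    fromℤ-⊖ zero (suc n) = trans (fromℤ-neg (suc n)) (sym (+-identityˡ _))
    fromℤ-⊖ (suc m) (suc n) rewrite ℤ.[1+m]⊖[1+n]≡m⊖n m n = begin
      fromℤ (m ⊖ n)                              ≈⟨ fromℤ-⊖ m n ⟩
      fromℕ m - fromℕ n                          ≈⟨ +-identityˡ _ ⟨
      0# + (fromℕ m - fromℕ n)                   ≈⟨ +-congʳ (-‿inverseʳ 1#) ⟨
      1# - 1# + (fromℕ m - fromℕ n)              ≈⟨ +-assoc _ _ _ ⟩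
      1# + (- 1# + (fromℕ m - fromℕ n))          ≈⟨ +-congˡ (+-assoc _ _ _) ⟨
      1# + (- 1# + fromℕ m - fromℕ n)            ≈⟨ +-congˡ (+-congʳ (+-comm _ _)) ⟩
      1# + (fromℕ m + - 1# - fromℕ n)            ≈⟨ +-congˡ (+-assoc _ _ _) ⟩
      1# + (fromℕ m + (- 1# - fromℕ n))          ≈⟨ +-congˡ (+-congˡ (-‿+-comm _ _)) ⟩
      1# + (fromℕ m - fromℕ (suc n))             ≈⟨ +-assoc _ _ _ ⟨
      fromℕ (suc m) - fromℕ (suc n)              ∎

    fromℤ-+ : ∀ i j → fromℤ (i ℤ.+ j) ≈ fromℤ i + fromℤ j
    fromℤ-+ (+ m) (+ n) = begin
      fromℤ (+ (m ℕ.+ n))     ≈⟨ fromℕ≈ (m ℕ.+ n) ⟩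
      fromℕ (m ℕ.+ n)         ≈⟨ ×-homo-+ 1# m n ⟩
      fromℕ m + fromℕ n       ≈⟨ +-cong (fromℕ≈ m) (fromℕ≈ n) ⟨
      fromℤ (+ m) + fromℤ (+ n) ∎
    fromℤ-+ (+ m) -[1+ n ] = trans (fromℤ-⊖ m (suc n))
      (sym (+-cong (fromℕ≈ m) (-‿cong (fromℕ≈ (suc n)))))
    fromℤ-+ -[1+ m ] (+ n) = trans (fromℤ-⊖ n (suc m)) (trans (+-comm _ _)
      (sym (+-cong (-‿cong (fromℕ≈ (suc m))) (fromℕ≈ n))))
    fromℤ-+ -[1+ m ] -[1+ n ] = begin
      fromℤ -[1+ suc (m ℕ.+ n) ]             ≈⟨ -‿cong (fromℕ≈ (2 ℕ.+ (m ℕ.+ n))) ⟩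
      - fromℕ (2 ℕ.+ (m ℕ.+ n))              ≡⟨ ≡.cong (λ k → - fromℕ (suc k)) (ℕ.+-suc m n) ⟨
      - fromℕ (suc m ℕ.+ suc n)              ≈⟨ -‿cong (×-homo-+ 1# (suc m) (suc n)) ⟩
      - (fromℕ (suc m) + fromℕ (suc n))      ≈⟨ -‿+-comm _ _ ⟨
      - fromℕ (suc m) - fromℕ (suc n)        ≈⟨ +-cong (-‿cong (fromℕ≈ (suc m))) (-‿cong (fromℕ≈ (suc n))) ⟨
      fromℤ -[1+ m ] + fromℤ -[1+ n ]        ∎

    fromℕ-*′ : ∀ m n → fromℕ (m ℕ.* n) ≈ (m ×′ 1#) * (n ×′ 1#)
    fromℕ-*′ m n = trans (×1-homo-* m n) (sym (*-cong (fromℕ≈ m) (fromℕ≈ n)))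

    fromℤ-* : ∀ i j → fromℤ (i ℤ.* j) ≈ fromℤ i * fromℤ j
    fromℤ-* (+ m) (+ n) rewrite ℤ.+◃n≡+n (m ℕ.* n) = trans (fromℕ≈ (m ℕ.* n)) (fromℕ-*′ m n)
    fromℤ-* (+ m) -[1+ n ] rewrite ℤ.-◃n≡-n (m ℕ.* suc n) = begin
      fromℤ (ℤ.- (+ (m ℕ.* suc n)))    ≈⟨ fromℤ-neg (m ℕ.* suc n) ⟩
      - fromℕ (m ℕ.* suc n)            ≈⟨ -‿cong (fromℕ-*′ m (suc n)) ⟩
      - ((m ×′ 1#) * (suc n ×′ 1#))    ≈⟨ -‿distribʳ-* _ _ ⟩
      (m ×′ 1#) * - (suc n ×′ 1#)      ∎
    fromℤ-* -[1+ m ] (+ n) rewrite ℤ.-◃n≡-n (suc m ℕ.* n) = begin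
      fromℤ (ℤ.- (+ (suc m ℕ.* n)))    ≈⟨ fromℤ-neg (suc m ℕ.* n) ⟩
      - fromℕ (suc m ℕ.* n)            ≈⟨ -‿cong (fromℕ-*′ (suc m) n) ⟩
      - ((suc m ×′ 1#) * (n ×′ 1#))    ≈⟨ -‿distribˡ-* _ _ ⟩
      - (suc m ×′ 1#) * (n ×′ 1#)      ∎
    fromℤ-* -[1+ m ] -[1+ n ] = begin
      fromℤ (+ (suc m ℕ.* suc n))            ≈⟨ fromℕ≈ (suc m ℕ.* suc n) ⟩
      fromℕ (suc m ℕ.* suc n)                ≈⟨ fromℕ-*′ (suc m) (suc n) ⟩
      (suc m ×′ 1#) * (suc n ×′ 1#)          ≈⟨ -‿involutive _ ⟨
      - - ((suc m ×′ 1#) * (suc n ×′ 1#))    ≈⟨ -‿cong (-‿distribʳ-* _ _) ⟩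
      - ((suc m ×′ 1#) * - (suc n ×′ 1#))    ≈⟨ -‿distribˡ-* _ _ ⟩
      - (suc m ×′ 1#) * - (suc n ×′ 1#)      ∎

    fromℤ-‿- : ∀ i → fromℤ (ℤ.- i) ≈ - fromℤ i
    fromℤ-‿- (+ n)    = trans (fromℤ-neg n) (-‿cong (sym (fromℕ≈ n)))
    fromℤ-‿- -[1+ n ] = sym (-‿involutive _)

    morphism : ℤ.+-*-rawRing -Raw-AlmostCommutative⟶ fromCommutativeRing commutativeRing
    morphism = record
      { ⟦_⟧    = fromℤ
      ; +-homo = fromℤ-+
      ; *-homo = fromℤ-*
      ; -‿homo = fromℤ-‿-
      ; 0-homo = refl
      ; 1-homo = refl
      }

    fromℤ-weaklyDecidable : ∀ i j → Maybe.Maybe (fromℤ i ≈ fromℤ j)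
    fromℤ-weaklyDecidable i j = Maybe.map (CommutativeRing.reflexive commutativeRing ∘ ≡.cong fromℤ) (dec⇒maybe (i ℤ.≟ j))

    open RingSolver ℤ.+-*-rawRing (fromCommutativeRing commutativeRing) morphism fromℤ-weaklyDecidable public
      using (solve; con; _:+_; _:*_; :-_; _:-_; _:=_)

  open Solver using (solve; con; _:+_; _:*_; :-_; _:-_; _:=_)

  open PosetReasoning poset

  -- Ordered field arithmetic

  <⇒≤ : ∀ {x y} → x < y → x ≤ y
  <⇒≤ = proj₁

  <⇒≱ : ∀ {x y} → x < y → ¬ (y ≤ x)
  <⇒≱ = ToStrict.<⇒≱ _≈_ _≤_ antisym

  ≰⇒> : ∀ {x y} → ¬ (x ≤ y) → y < x
  ≰⇒> = ToStrict.≰⇒> _≈_ _≤_ sym ≤-reflexive total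

  <-trans : ∀ {x y z} → x < y → y < z → x < z
  <-trans = ToStrict.<-trans _≈_ _≤_ isPartialOrder

  -- Archimedean choices are only available under double negation.
  ≤-stable : ∀ {x y} → ¬ ¬ (x ≤ y) → x ≤ y
  ≤-stable = decidable-stable (_ ≤? _)

  ≮⇒≥ : ∀ {x y} → ¬ (x < y) → y ≤ x
  ≮⇒≥ x≮y = ≤-stable (x≮y ∘ ≰⇒>)

  ≤-by : ∀ {x y} d → 0# ≤ d → d + x ≈ y → x ≤ y
  ≤-by {x} {y} d 0≤d d+x≈y = begin
    x       ≈⟨ +-identityˡ x ⟨
    0# + x  ≤⟨ +-monoˡ-≤ x 0≤d ⟩
    d + x   ≈⟨ d+x≈y ⟩
    y       ∎

  <-by : ∀ {x y} d → 0# < d → d + x ≈ y → x < y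
  <-by {x} {y} d (0≤d , 0≉d) d+x≈y = ≤-by d 0≤d d+x≈y , λ x≈y → 0≉d (begin-equality
    0#         ≈⟨ -‿inverseʳ x ⟨
    x - x      ≈⟨ +-congʳ (trans x≈y (sym d+x≈y)) ⟩
    d + x - x  ≈⟨ solve 2 (λ d x → d :+ x :- x := d) refl d x ⟩
    d          ∎)

  x≤y⇒0≤y-x : ∀ {x y} → x ≤ y → 0# ≤ y - x
  x≤y⇒0≤y-x {x} {y} x≤y = begin
    0#     ≈⟨ -‿inverseʳ x ⟨
    x - x  ≤⟨ +-monoˡ-≤ (- x) x≤y ⟩
    y - x  ∎

  x<y⇒0<y-x : ∀ {x y} → x < y → 0# < y - x
  x<y⇒0<y-x {x} {y} (x≤y , x≉y) = x≤y⇒0≤y-x x≤y , λ 0≈y-x → x≉y (begin-equality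
    x            ≈⟨ +-identityˡ x ⟨
    0# + x       ≈⟨ +-congʳ 0≈y-x ⟩
    y - x + x    ≈⟨ solve 2 (λ x y → y :- x :+ x := y) refl x y ⟩
    y            ∎)

  +-mono-≤ : ∀ {x y u v} → x ≤ y → u ≤ v → x + u ≤ y + v
  +-mono-≤ {x} {y} {u} {v} x≤y u≤v = begin
    x + u  ≤⟨ +-monoˡ-≤ u x≤y ⟩
    y + u  ≈⟨ +-comm y u ⟩
    u + y  ≤⟨ +-monoˡ-≤ y u≤v ⟩
    v + y  ≈⟨ +-comm v y ⟩
    y + v  ∎

  +-nonNegative : ∀ {x y} → 0# ≤ x → 0# ≤ y → 0# ≤ x + y
  +-nonNegative 0≤x 0≤y = ≤-trans (≤-reflexive (sym (+-identityˡ 0#))) (+-mono-≤ 0≤x 0≤y)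

  +-positive : ∀ {x y} → 0# < x → 0# ≤ y → 0# < x + y
  +-positive {x} {y} 0<x 0≤y = begin-strict
    0#      <⟨ 0<x ⟩
    x       ≤⟨ ≤-by y 0≤y (+-comm y x) ⟩
    x + y   ∎

  *-monoˡ-≤ : ∀ {x y} z → 0# ≤ z → x ≤ y → z * x ≤ z * y
  *-monoˡ-≤ {x} {y} z 0≤z x≤y = ≤-by (z * (y - x)) (*-nonNegative 0≤z (x≤y⇒0≤y-x x≤y))
    (solve 3 (λ x y z → z :* (y :- x) :+ z :* x := z :* y) refl x y z)

  *-mono-≤ : ∀ {x y u v} → 0# ≤ u → 0# ≤ y → x ≤ y → u ≤ v → x * u ≤ y * v
  *-mono-≤ {x} {y} {u} {v} 0≤u 0≤y x≤y u≤v = begin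
    x * u  ≈⟨ *-comm x u ⟩
    u * x  ≤⟨ *-monoˡ-≤ u 0≤u x≤y ⟩
    u * y  ≈⟨ *-comm u y ⟩
    y * u  ≤⟨ *-monoˡ-≤ y 0≤y u≤v ⟩
    y * v  ∎

  0≤x² : ∀ x → 0# ≤ x * x
  0≤x² x = [ (λ 0≤x → *-nonNegative 0≤x 0≤x) , nonPositive ]′ (total 0# x)
    where
    nonPositive : x ≤ 0# → 0# ≤ x * x
    nonPositive x≤0 = begin
      0#                     ≤⟨ *-nonNegative (x≤y⇒0≤y-x x≤0) (x≤y⇒0≤y-x x≤0) ⟩
      (0# - x) * (0# - x)    ≈⟨ solve 1 (λ x → (con (+ 0) :- x) :* (con (+ 0) :- x) := x :* x) refl x ⟩
      x * x                  ∎

  0<1 : 0# < 1#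
  0<1 = ≤-trans (0≤x² 1#) (≤-reflexive (*-identityˡ 1#)) , 0≉1

  1≤x⇒0<x : ∀ {x} → 1# ≤ x → 0# < x
  1≤x⇒0<x {x} 1≤x = begin-strict
    0#    <⟨ 0<1 ⟩
    1#    ≤⟨ 1≤x ⟩
    x     ∎

  0<⇒≉0 : ∀ {x} → 0# < x → ¬ (x ≈ 0#)
  0<⇒≉0 (_ , 0≉x) = 0≉x ∘ sym

  *-cancelˡ-≈ : ∀ {x y} z → ¬ (z ≈ 0#) → z * x ≈ z * y → x ≈ y
  *-cancelˡ-≈ {x} {y} z z≉0 zx≈zy = begin-equality
    x               ≈⟨ *-identityˡ x ⟨
    1# * x          ≈⟨ *-congʳ (*-inverseʳ z z≉0) ⟨
    z * z ⁻¹ * x    ≈⟨ solve 3 (λ z i x → z :* i :* x := i :* (z :* x)) refl z (z ⁻¹) x ⟩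
    z ⁻¹ * (z * x)  ≈⟨ *-congˡ zx≈zy ⟩
    z ⁻¹ * (z * y)  ≈⟨ solve 3 (λ z i x → z :* i :* x := i :* (z :* x)) refl z (z ⁻¹) y ⟨
    z * z ⁻¹ * y    ≈⟨ *-congʳ (*-inverseʳ z z≉0) ⟩
    1# * y          ≈⟨ *-identityˡ y ⟩
    y               ∎

  *-positive : ∀ {x y} → 0# < x → 0# < y → 0# < x * y
  *-positive {x} {y} 0<x (0≤y , 0≉y) = *-nonNegative (<⇒≤ 0<x) 0≤y ,
    λ 0≈xy → 0≉y (*-cancelˡ-≈ x (0<⇒≉0 0<x) (trans (zeroʳ x) 0≈xy))

  *-monoˡ-< : ∀ {x y} z → 0# < z → x < y → z * x < z * y
  *-monoˡ-< {x} {y} z 0<z x<y = <-by (z * (y - x)) (*-positive 0<z (x<y⇒0<y-x x<y))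
    (solve 3 (λ x y z → z :* (y :- x) :+ z :* x := z :* y) refl x y z)

  *-cancelˡ-≤ : ∀ {x y} z → 0# < z → z * x ≤ z * y → x ≤ y
  *-cancelˡ-≤ z 0<z zx≤zy = ≤-stable λ x≰y → <⇒≱ (*-monoˡ-< z 0<z (≰⇒> x≰y)) zx≤zy

  ⁻¹-inverse : ∀ {x} → 0# < x → x * x ⁻¹ ≈ 1#
  ⁻¹-inverse 0<x = *-inverseʳ _ (0<⇒≉0 0<x)

  ⁻¹-positive : ∀ {x} → 0# < x → 0# < x ⁻¹
  ⁻¹-positive {x} 0<x = ≰⇒> λ x⁻¹≤0 → <⇒≱ 0<1 (begin
    1#         ≈⟨ ⁻¹-inverse 0<x ⟨
    x * x ⁻¹   ≤⟨ *-monoˡ-≤ x (<⇒≤ 0<x) x⁻¹≤0 ⟩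
    x * 0#     ≈⟨ zeroʳ x ⟩
    0#         ∎)

  <-respʳ-≈ : ∀ {x y z} → y ≈ z → x < y → x < z
  <-respʳ-≈ = ToStrict.<-respʳ-≈ _≈_ _≤_ sym trans (λ y≈z x≤y → ≤-trans x≤y (≤-reflexive y≈z))

  2# : Carrier
  2# = 1# + 1#

  0<2 : 0# < 2#
  0<2 = +-positive 0<1 (<⇒≤ 0<1)

  ½ : Carrier
  ½ = 2# ⁻¹

  0<½ : 0# < ½
  0<½ = ⁻¹-positive 0<2

  ½+½≈1 : ½ + ½ ≈ 1#
  ½+½≈1 = trans (solve 1 (λ h → h :+ h := con (+ 2) :* h) refl ½) (⁻¹-inverse 0<2)

  2*½* : ∀ x → 2# * (½ * x) ≈ x
  2*½* x = trans (sym (*-assoc 2# ½ x)) (trans (*-congʳ (⁻¹-inverse 0<2)) (*-identityˡ x))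

  -- If c < 0, the choice ε = -c/2 leaves c + ε = -ε < 0.
  0≤-upTo-ε : ∀ {c} → (∀ ε → 0# < ε → 0# ≤ c + ε) → 0# ≤ c
  0≤-upTo-ε {c} 0≤c+ε = ≤-stable λ 0≰c →
    let 0<-c = <-respʳ-≈ (+-identityˡ (- c)) (x<y⇒0<y-x (≰⇒> 0≰c))
        0<ε  = *-positive 0<½ 0<-c
    in <⇒≱ 0<ε (≤-by (c + ½ * - c) (0≤c+ε (½ * - c) 0<ε) (begin-equality
      c + ½ * - c + ½ * - c   ≈⟨ solve 2 (λ c h → c :+ h :* :- c :+ h :* :- c := c :+ (h :+ h) :* :- c) refl c ½ ⟩
      c + (½ + ½) * - c       ≈⟨ +-congˡ (*-congʳ ½+½≈1) ⟩
      c + 1# * - c            ≈⟨ solve 1 (λ c → c :+ con (+ 1) :* :- c := con (+ 0)) refl c ⟩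
      0#                      ∎))

  -- Natural powers, Bernoulli's inequality and the Archimedean property

  0≤fromℕ : ∀ n → 0# ≤ fromℕ n
  0≤fromℕ zero    = ≤-refl
  0≤fromℕ (suc n) = +-nonNegative (<⇒≤ 0<1) (0≤fromℕ n)

  0<fromℕ-suc : ∀ n → 0# < fromℕ (suc n)
  0<fromℕ-suc n = +-positive 0<1 (0≤fromℕ n)

  0<fromℕ : ∀ {n} → 0 ℕ.< n → 0# < fromℕ n
  0<fromℕ {suc n} _ = 0<fromℕ-suc n

  ^-positive : ∀ {x} n → 0# < x → 0# < x ^ n
  ^-positive zero    0<x = 0<1
  ^-positive (suc n) 0<x = *-positive 0<x (^-positive n 0<x)

  ^-mono-≤ : ∀ {x y} n → 0# < x → x ≤ y → x ^ n ≤ y ^ n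
  ^-mono-≤ zero    0<x x≤y = ≤-refl
  ^-mono-≤ (suc n) 0<x x≤y =
    *-mono-≤ (<⇒≤ (^-positive n 0<x)) (≤-trans (<⇒≤ 0<x) x≤y) x≤y (^-mono-≤ n 0<x x≤y)

  1^n≈1 : ∀ n → 1# ^ n ≈ 1#
  1^n≈1 zero    = refl
  1^n≈1 (suc n) = trans (*-identityˡ _) (1^n≈1 n)

  -- Bases below 1 are included because the logarithm applies it to them. In the induction step, x
  -- (1 + n (x - 1)) exceeds the next linear bound by n (x - 1)².
  bernoulli : ∀ {x} n → 0# ≤ x → 1# + fromℕ n * (x - 1#) ≤ x ^ n
  bernoulli {x} zero    0≤x = ≤-reflexive (solve 1 (λ x → con (+ 1) :+ con (+ 0) :* (x :- con (+ 1)) := con (+ 1)) refl x)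
  bernoulli {x} (suc n) 0≤x = begin
    1# + (1# + fromℕ n) * (x - 1#)    ≤⟨ ≤-by (fromℕ n * ((x - 1#) * (x - 1#))) (*-nonNegative (0≤fromℕ n) (0≤x² _))
                                           (solve 2 (λ n x → n :* ((x :- con (+ 1)) :* (x :- con (+ 1))) :+ (con (+ 1) :+ (con (+ 1) :+ n) :* (x :- con (+ 1)))
                                                               := x :* (con (+ 1) :+ n :* (x :- con (+ 1)))) refl (fromℕ n) x) ⟩
    x * (1# + fromℕ n * (x - 1#))     ≤⟨ *-monoˡ-≤ x 0≤x (bernoulli n 0≤x) ⟩
    x * x ^ n                         ∎

  -- If no natural number exceeds x, the natural numbers have a supremum s. From n + 1 ≤ s for all
  -- n, the number s - 1 is an upper bound too, so s ≤ s - 1.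
  archimedean : ∀ x → ¬ ¬ (∃[ n ] x < fromℕ n)
  archimedean x none = <⇒≱ 0<1 (≤-by (s - 1# - s) (x≤y⇒0≤y-x s≤s-1)
    (solve 1 (λ s → s :- con (+ 1) :- s :+ con (+ 1) := con (+ 0)) refl s))
    where
    P : Pred Carrier 0ℓ
    P y = ∃[ n ] y ≈ fromℕ n
    sat : Satisfiable P
    sat = 0# , 0 , refl
    s = sup P
    upper : UpperBound P s
    upper = sup-upper P sat (x , λ { y (n , y≈n) → ≤-trans (≤-reflexive y≈n) (≮⇒≥ λ x<n → none (n , x<n)) })
    s≤s-1 : s ≤ s - 1#
    s≤s-1 = sup-least P sat (s - 1#) λ { y (n , y≈n) → ≤-by (s - fromℕ (suc n)) (x≤y⇒0≤y-x (upper _ (suc n , refl)))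
      (trans (+-congˡ y≈n) (solve 2 (λ s n → s :- (con (+ 1) :+ n) :+ n := s :- con (+ 1)) refl s (fromℕ n))) }

  archimedean-* : ∀ x {d} → 0# < d → ¬ ¬ (∃[ n ] x < fromℕ n * d)
  archimedean-* x {d} 0<d none = archimedean (x * d ⁻¹) λ { (n , x/d<n) → none (n , (begin-strict
    x               ≈⟨ *-identityʳ x ⟨
    x * 1#          ≈⟨ *-congˡ (⁻¹-inverse 0<d) ⟨
    x * (d * d ⁻¹)  ≈⟨ solve 3 (λ x d e → x :* (d :* e) := d :* (x :* e)) refl x d (d ⁻¹) ⟩
    d * (x * d ⁻¹)  <⟨ *-monoˡ-< d 0<d x/d<n ⟩
    d * fromℕ n     ≈⟨ *-comm d (fromℕ n) ⟩
    fromℕ n * d     ∎)) }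

  ^-unbounded : ∀ x {z} → 1# < z → ¬ ¬ (∃[ n ] x < z ^ n)
  ^-unbounded x {z} 1<z none = archimedean-* x (x<y⇒0<y-x 1<z) λ { (n , x<) → none (n , (begin-strict
    x                          <⟨ x< ⟩
    fromℕ n * (z - 1#)         ≤⟨ ≤-by 1# (<⇒≤ 0<1) refl ⟩
    1# + fromℕ n * (z - 1#)    ≤⟨ bernoulli n (≤-trans (<⇒≤ 0<1) (<⇒≤ 1<z)) ⟩
    z ^ n                      ∎)) }

  -- Downward search from n. It locates a real number between consecutive members of a sequence:
  -- powers of a base for the logarithm, natural numbers for rational exponents.
  crossing : ∀ {P : Pred ℕ 0ℓ} → Decidable P → P 0 → ∀ n → ¬ P n → ∃[ k ] (P k × ¬ P (suc k))
  crossing P? P0 zero    ¬P0 = contradiction P0 ¬P0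
  crossing P? P0 (suc n) ¬Pn with P? n
  ... | yes Pn = n , Pn , ¬Pn
  ... | no ¬Pn = crossing P? P0 n ¬Pn

  -- The logarithm and its elementary bounds

  sup-cong : ∀ {P Q : Pred Carrier 0ℓ} → Satisfiable P → Satisfiable (UpperBound P) →
             (∀ {x} → P x → Q x) → (∀ {x} → Q x → P x) → sup P ≈ sup Q
  sup-cong {P} {Q} (x , Px) (u , P≤u) P⇒Q Q⇒P = antisym
    (sup-least P (x , Px) (sup Q) λ y Py → sup-upper Q (x , P⇒Q Px) (u , λ z → P≤u z ∘ Q⇒P) y (P⇒Q Py))
    (sup-least Q (x , P⇒Q Px) (sup P) λ y Qy → sup-upper P (x , Px) (u , P≤u) y (Q⇒P Qy))

  -- If z = w⁻¹ then z ^ n ≤ x, so log x ≥ n log z ≥ n (1 - z⁻¹) = n (1 - w).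
  LogBound : Carrier → Pred Carrier 0ℓ
  LogBound x s = ∃[ n ] ∃[ w ] (0 ℕ.< n × 0# < w × 1# ≤ x * w ^ n × s ≈ fromℕ n * (1# - w))

  log : Carrier → Carrier
  log x = sup (LogBound x)

  logBound-sat : ∀ {x} → 0# < x → LogBound x (1# - x ⁻¹)
  logBound-sat {x} 0<x = 1 , x ⁻¹ , ℕ.z<s , ⁻¹-positive 0<x ,
    ≤-reflexive (sym (trans (*-congˡ (*-identityʳ _)) (⁻¹-inverse 0<x))) ,
    solve 1 (λ i → con (+ 1) :- i := (con (+ 1) :+ con (+ 0)) :* (con (+ 1) :- i)) refl (x ⁻¹)

  -- For v = 1/w the condition on w reads v ^ N ≤ x, and Bernoulli bounds N (v - 1) by v ^ N - 1.
  -- The passage from 1 - w to v - 1 costs (w - 1)²/w ≥ 0.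
  logBound-upper : ∀ {x} → 0# < x → UpperBound (LogBound x) (x - 1#)
  logBound-upper {x} 0<x s (N , w , _ , 0<w , 1≤xwⁿ , s≈) = begin
    s                       ≈⟨ s≈ ⟩
    fromℕ N * (1# - w)      ≤⟨ *-monoˡ-≤ (fromℕ N) (0≤fromℕ N) 1-w≤v-1 ⟩
    fromℕ N * (v - 1#)      ≤⟨ ≤-by (v ^ N - (1# + fromℕ N * (v - 1#))) (x≤y⇒0≤y-x (bernoulli N (<⇒≤ 0<v)))
                                 (solve 2 (λ a b → b :- (con (+ 1) :+ a) :+ a := b :- con (+ 1)) refl (fromℕ N * (v - 1#)) (v ^ N)) ⟩
    v ^ N - 1#              ≤⟨ +-monoˡ-≤ (- 1#) vᴺ≤x ⟩
    x - 1#                  ∎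
    where
    v = w ⁻¹
    0<v = ⁻¹-positive 0<w
    1-w≤v-1 : 1# - w ≤ v - 1#
    1-w≤v-1 = *-cancelˡ-≤ w 0<w (≤-by ((w - 1#) * (w - 1#)) (0≤x² _) (begin-equality
      (w - 1#) * (w - 1#) + w * (1# - w)  ≈⟨ solve 1 (λ w → (w :- con (+ 1)) :* (w :- con (+ 1)) :+ w :* (con (+ 1) :- w) := con (+ 1) :- w) refl w ⟩
      1# - w                              ≈⟨ +-congʳ (⁻¹-inverse 0<w) ⟨
      w * v - w                           ≈⟨ solve 2 (λ w v → w :* v :- w := w :* (v :- con (+ 1))) refl w v ⟩
      w * (v - 1#)                        ∎))
    vᴺ≤x : v ^ N ≤ x
    vᴺ≤x = *-cancelˡ-≤ (w ^ N) (^-positive N 0<w) (begin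
      w ^ N * v ^ N    ≈⟨ ^-distrib-* w v N ⟨
      (w * v) ^ N      ≈⟨ ^-congˡ N (⁻¹-inverse 0<w) ⟩
      1# ^ N           ≈⟨ 1^n≈1 N ⟩
      1#               ≤⟨ 1≤xwⁿ ⟩
      x * w ^ N        ≈⟨ *-comm x (w ^ N) ⟩
      w ^ N * x        ∎)

  logBound⇒≤log : ∀ {x s} → 0# < x → LogBound x s → s ≤ log x
  logBound⇒≤log {x} 0<x = sup-upper (LogBound x) (_ , logBound-sat 0<x) (_ , logBound-upper 0<x) _

  log≤ : ∀ {x} u → 0# < x → UpperBound (LogBound x) u → log x ≤ u
  log≤ u 0<x = sup-least _ (_ , logBound-sat 0<x) u

  log≤x-1 : ∀ {x} → 0# < x → log x ≤ x - 1#
  log≤x-1 0<x = log≤ _ 0<x (logBound-upper 0<x)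

  1-x⁻¹≤log : ∀ {x} → 0# < x → 1# - x ⁻¹ ≤ log x
  1-x⁻¹≤log 0<x = logBound⇒≤log 0<x (logBound-sat 0<x)

  log-cong : ∀ {x y} → 0# < x → x ≈ y → log x ≈ log y
  log-cong 0<x x≈y = sup-cong (_ , logBound-sat 0<x) (_ , logBound-upper 0<x) (transfer x≈y) (transfer (sym x≈y))
    where
    transfer : ∀ {x y s} → x ≈ y → LogBound x s → LogBound y s
    transfer x≈y (n , w , 0<n , 0<w , 1≤ , s≈) = n , w , 0<n , 0<w , ≤-trans 1≤ (≤-reflexive (*-congʳ x≈y)) , s≈

  log1≈0 : log 1# ≈ 0#
  log1≈0 = antisym (≤-trans (log≤x-1 0<1) (≤-reflexive (-‿inverseʳ 1#))) (begin
    0#            ≈⟨ -‿inverseʳ 1# ⟨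
    1# - 1#       ≈⟨ +-congˡ (-‿cong (trans (sym (*-identityˡ _)) (⁻¹-inverse 0<1))) ⟨
    1# - 1# ⁻¹    ≤⟨ 1-x⁻¹≤log 0<1 ⟩
    log 1#        ∎)

  1≤x⇒0≤log : ∀ {x} → 1# ≤ x → 0# ≤ log x
  1≤x⇒0≤log {x} 1≤x = ≤-trans 0≤1-x⁻¹ (1-x⁻¹≤log 0<x)
    where
    0<x : 0# < x
    0<x = 1≤x⇒0<x 1≤x
    0≤1-x⁻¹ : 0# ≤ 1# - x ⁻¹
    0≤1-x⁻¹ = *-cancelˡ-≤ x 0<x (begin
      x * 0#             ≈⟨ zeroʳ x ⟩
      0#                 ≤⟨ x≤y⇒0≤y-x 1≤x ⟩
      x - 1#             ≈⟨ +-congˡ (-‿cong (⁻¹-inverse 0<x)) ⟨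
      x - x * x ⁻¹       ≈⟨ solve 2 (λ x i → x :- x :* i := x :* (con (+ 1) :- i)) refl x (x ⁻¹) ⟩
      x * (1# - x ⁻¹)    ∎)

  -- Additivity of the logarithm

  -- A substitute for the k-th root of w: v is the arithmetic mean of w and k - 1 ones. This choice
  -- keeps the linear term exact, while Bernoulli gives the power estimate. A witness of `LogBound`
  -- can thus pass to a k times larger exponent without changing its value.
  refine : ∀ {w k} → 0 ℕ.< k → 0# < w → ∃[ v ] (0# < v × w ≤ v ^ k × fromℕ k * (1# - v) ≈ 1# - w)
  refine {w} {suc k} _ 0<w = v , 0<v , w≤vᵏ , k[1-v]
    where
    K = fromℕ (suc k)
    0<K = 0<fromℕ-suc k
    v = (w + fromℕ k) * K ⁻¹
    0<v : 0# < v
    0<v = *-positive (+-positive 0<w (0≤fromℕ k)) (⁻¹-positive 0<K)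
    k[1-v] : K * (1# - v) ≈ 1# - w
    k[1-v] = begin-equality
      K * (1# - (w + fromℕ k) * K ⁻¹)      ≈⟨ solve 4 (λ K w k i → K :* (con (+ 1) :- (w :+ k) :* i) := K :- (w :+ k) :* (K :* i)) refl K w (fromℕ k) (K ⁻¹) ⟩
      K - (w + fromℕ k) * (K * K ⁻¹)       ≈⟨ +-congˡ (-‿cong (*-congˡ (⁻¹-inverse 0<K))) ⟩
      K - (w + fromℕ k) * 1#               ≈⟨ solve 2 (λ w k → con (+ 1) :+ k :- (w :+ k) :* con (+ 1) := con (+ 1) :- w) refl w (fromℕ k) ⟩
      1# - w                               ∎
    w≤vᵏ : w ≤ v ^ suc k
    w≤vᵏ = begin
      w                         ≈⟨ solve 1 (λ w → w := con (+ 1) :- (con (+ 1) :- w)) refl w ⟩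
      1# - (1# - w)             ≈⟨ +-congˡ (-‿cong k[1-v]) ⟨
      1# - K * (1# - v)         ≈⟨ solve 2 (λ K v → con (+ 1) :- K :* (con (+ 1) :- v) := con (+ 1) :+ K :* (v :- con (+ 1))) refl K v ⟩
      1# + K * (v - 1#)         ≤⟨ bernoulli (suc k) (<⇒≤ 0<v) ⟩
      v ^ suc k                 ∎

  -- Merges two witnesses with the same exponent n into one with exponent 2n. The midpoint u is used
  -- because n (1 - w) + n (1 - v) = 2n (1 - u) holds exactly; the power estimate is w v ≤ u².
  am-gm-^ : ∀ {w v} n → 0# < w → 0# < v → w ^ n * v ^ n ≤ (½ * (w + v)) ^ (n ℕ.+ n)
  am-gm-^ {w} {v} n 0<w 0<v = begin
    w ^ n * v ^ n    ≈⟨ ^-distrib-* w v n ⟨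
    (w * v) ^ n      ≤⟨ ^-mono-≤ n (*-positive 0<w 0<v) wv≤u² ⟩
    (u * u) ^ n      ≈⟨ ^-distrib-* u u n ⟩
    u ^ n * u ^ n    ≈⟨ ^-homo-* u n n ⟨
    u ^ (n ℕ.+ n)    ∎
    where
    u = ½ * (w + v)
    wv≤u² : w * v ≤ u * u
    wv≤u² = *-cancelˡ-≤ (2# * 2#) (*-positive 0<2 0<2) (≤-by ((w - v) * (w - v)) (0≤x² _) (begin-equality
      (w - v) * (w - v) + 2# * 2# * (w * v)  ≈⟨ solve 2 (λ w v → (w :- v) :* (w :- v) :+ con (+ 2) :* con (+ 2) :* (w :* v) := (w :+ v) :* (w :+ v)) refl w v ⟩
      (w + v) * (w + v)                      ≈⟨ *-cong (2*½* (w + v)) (2*½* (w + v)) ⟨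
      2# * u * (2# * u)                      ≈⟨ solve 2 (λ a u → a :* u :* (a :* u) := a :* a :* (u :* u)) refl 2# u ⟩
      2# * 2# * (u * u)                      ∎))

  -- Both witnesses are first refined to the common exponent n m.
  logBound-+ : ∀ {x y s t} → 0# < x → 0# < y → LogBound x s → LogBound y t → LogBound (x * y) (s + t)
  logBound-+ {x} {y} {s} {t} 0<x 0<y (n , w , 0<n , 0<w , 1≤xw , s≈) (m , v , 0<m , 0<v , 1≤yv , t≈)
    with w′ , 0<w′ , w≤ , w′≈ ← refine 0<m 0<w
       | v′ , 0<v′ , v≤ , v′≈ ← refine 0<n 0<v
    = N ℕ.+ N , u , ℕ.<-≤-trans (ℕ.*-mono-< 0<n 0<m) (ℕ.m≤m+n N N) , 0<u , 1≤ , s+t≈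
    where
    N = n ℕ.* m
    u = ½ * (w′ + v′)
    0<u = *-positive 0<½ (+-positive 0<w′ (<⇒≤ 0<v′))
    wⁿ≤ : w ^ n ≤ w′ ^ N
    wⁿ≤ = begin
      w ^ n            ≤⟨ ^-mono-≤ n 0<w w≤ ⟩
      (w′ ^ m) ^ n     ≈⟨ ^-assocʳ w′ m n ⟩
      w′ ^ (m ℕ.* n)   ≡⟨ ≡.cong (w′ ^_) (ℕ.*-comm m n) ⟩
      w′ ^ N           ∎
    vᵐ≤ : v ^ m ≤ v′ ^ N
    vᵐ≤ = begin
      v ^ m            ≤⟨ ^-mono-≤ m 0<v v≤ ⟩
      (v′ ^ n) ^ m     ≈⟨ ^-assocʳ v′ n m ⟩
      v′ ^ N           ∎
    1≤ : 1# ≤ x * y * u ^ (N ℕ.+ N)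
    1≤ = begin
      1#                             ≈⟨ *-identityˡ 1# ⟨
      1# * 1#                        ≤⟨ *-mono-≤ (<⇒≤ 0<1) (<⇒≤ (*-positive 0<x (^-positive n 0<w))) 1≤xw 1≤yv ⟩
      x * w ^ n * (y * v ^ m)        ≤⟨ *-mono-≤ (<⇒≤ (*-positive 0<y (^-positive m 0<v))) (<⇒≤ (*-positive 0<x (^-positive N 0<w′)))
                                          (*-monoˡ-≤ x (<⇒≤ 0<x) wⁿ≤) (*-monoˡ-≤ y (<⇒≤ 0<y) vᵐ≤) ⟩
      x * w′ ^ N * (y * v′ ^ N)      ≈⟨ solve 4 (λ x y a b → x :* a :* (y :* b) := x :* y :* (a :* b)) refl x y (w′ ^ N) (v′ ^ N) ⟩
      x * y * (w′ ^ N * v′ ^ N)      ≤⟨ *-monoˡ-≤ (x * y) (<⇒≤ (*-positive 0<x 0<y)) (am-gm-^ N 0<w′ 0<v′) ⟩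
      x * y * u ^ (N ℕ.+ N)          ∎
    s+t≈ : s + t ≈ fromℕ (N ℕ.+ N) * (1# - u)
    s+t≈ = begin-equality
      s + t                                              ≈⟨ +-cong s≈ t≈ ⟩
      n′ * (1# - w) + m′ * (1# - v)                      ≈⟨ +-cong (*-congˡ w′≈) (*-congˡ v′≈) ⟨
      n′ * (m′ * (1# - w′)) + m′ * (n′ * (1# - v′))      ≈⟨ solve 4 (λ n m w v → n :* (m :* (con (+ 1) :- w)) :+ m :* (n :* (con (+ 1) :- v))
                                                                 := n :* m :* (con (+ 2) :- (w :+ v))) refl n′ m′ w′ v′ ⟩
      n′ * m′ * (2# - (w′ + v′))                         ≈⟨ *-cong (×1-homo-* n m) (+-congˡ (-‿cong (2*½* (w′ + v′)))) ⟨
      fromℕ N * (2# - 2# * u)                            ≈⟨ solve 2 (λ N u → N :* (con (+ 2) :- con (+ 2) :* u) := (N :+ N) :* (con (+ 1) :- u)) refl (fromℕ N) u ⟩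
      (fromℕ N + fromℕ N) * (1# - u)                     ≈⟨ *-congʳ (×-homo-+ 1# N N) ⟨
      fromℕ (N ℕ.+ N) * (1# - u)                         ∎
      where
      n′ = fromℕ n
      m′ = fromℕ m

  ≤-transpose : ∀ {a b c} → a + b ≤ c → a ≤ c - b
  ≤-transpose {a} {b} {c} a+b≤c = ≤-by (c - (a + b)) (x≤y⇒0≤y-x a+b≤c)
    (solve 3 (λ a b c → c :- (a :+ b) :+ a := c :- b) refl a b c)

  -- Lower bounds add by `logBound-+`, and taking suprema in one variable at a time gives this half
  -- of additivity. The other half has to wait for `log-⁻¹`.
  log-superadditive : ∀ {x y} → 0# < x → 0# < y → log x + log y ≤ log (x * y)
  log-superadditive {x} {y} 0<x 0<y = begin
    log x + log y                       ≤⟨ +-monoˡ-≤ (log y) (log≤ _ 0<x λ s x∋s → ≤-transpose (s+logy≤ s x∋s)) ⟩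
    log (x * y) - log y + log y         ≈⟨ solve 2 (λ a b → a :- b :+ b := a) refl (log (x * y)) (log y) ⟩
    log (x * y)                         ∎
    where
    s+logy≤ : ∀ s → LogBound x s → s + log y ≤ log (x * y)
    s+logy≤ s x∋s = begin
      s + log y                  ≈⟨ +-comm s (log y) ⟩
      log y + s                  ≤⟨ +-monoˡ-≤ s (log≤ _ 0<y λ t y∋t → ≤-transpose (≤-trans (≤-reflexive (+-comm t s))
                                      (logBound⇒≤log (*-positive 0<x 0<y) (logBound-+ 0<x 0<y x∋s y∋t)))) ⟩
      log (x * y) - s + s        ≈⟨ solve 2 (λ a b → a :- b :+ b := a) refl (log (x * y)) s ⟩
      log (x * y)                ∎

  -- Adds the exponent 0, which `LogBound` excludes but `crossing` may return; the bound is then 0,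
  -- and the condition says 1 ≤ x.
  log-lower : ∀ {x w} n → 0# < x → 0# < w → 1# ≤ x * w ^ n → fromℕ n * (1# - w) ≤ log x
  log-lower zero    0<x 0<w 1≤ = ≤-trans (≤-reflexive (zeroˡ _)) (1≤x⇒0≤log (≤-trans 1≤ (≤-reflexive (*-identityʳ _))))
  log-lower n@(suc _) 0<x 0<w 1≤ = logBound⇒≤log 0<x (n , _ , ℕ.z<s , 0<w , 1≤ , refl)

  -- Squeeze x between consecutive powers z ^ n ≤ x < z ^ (n + 1) of z = 1 + ε / x.
  log-inverse-≥1 : ∀ {x y} → 1# ≤ x → 0# < y → x * y ≈ 1# → 0# ≤ log x + log y
  log-inverse-≥1 {x} {y} 1≤x 0<y xy≈1 = 0≤-upTo-ε λ ε 0<ε → ≤-stable λ 0≰ →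
    let h   = ε * x ⁻¹
        0<h = *-positive 0<ε (⁻¹-positive 0<x)
    in ^-unbounded x (<-by h 0<h (+-comm h 1#)) λ { (k , x<zᵏ) →
         let n , zⁿ≤x , zⁿ⁺¹≰x = crossing (λ n → (1# + h) ^ n ≤? x) 1≤x k (<⇒≱ x<zᵏ)
         in 0≰ (bound ε h 0<h (ε≈ ε) n zⁿ≤x (<⇒≤ (≰⇒> zⁿ⁺¹≰x))) }
    where
    0<x : 0# < x
    0<x = 1≤x⇒0<x 1≤x
    ε≈ : ∀ ε → ε * x ⁻¹ * x ≈ ε
    ε≈ ε = begin-equality
      ε * x ⁻¹ * x      ≈⟨ solve 3 (λ e i x → e :* i :* x := e :* (x :* i)) refl ε (x ⁻¹) x ⟩
      ε * (x * x ⁻¹)    ≈⟨ *-congˡ (⁻¹-inverse 0<x) ⟩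
      ε * 1#            ≈⟨ *-identityʳ ε ⟩
      ε                 ∎
    -- The lower bounds for log x and log y add up to n (1 - w) - (n + 1) h, which equals -h n (1 -
    -- w) - h because 1 - w = w h. As n (1 - w) ≤ log x ≤ x - 1, the loss is at most h x = ε,
    -- whatever n is.
    bound : ∀ ε h → 0# < h → h * x ≈ ε → ∀ n → (1# + h) ^ n ≤ x → x ≤ (1# + h) ^ suc n → 0# ≤ log x + log y + ε
    bound ε h 0<h hx≈ε n zⁿ≤x x≤zⁿ⁺¹ = begin
      0#                                                            ≤⟨ *-nonNegative (<⇒≤ 0<h) (x≤y⇒0≤y-x (≤-trans lowerˣ (log≤x-1 0<x))) ⟩
      h * (x - 1# - fromℕ n * (1# - w))                             ≈⟨ solve 4 (λ h x n w → h :* (x :- con (+ 1) :- n :* (con (+ 1) :- w))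
                                                                         := h :* x :- h :- n :* h :+ n :* (w :* h)) refl h x (fromℕ n) w ⟩
      h * x - h - fromℕ n * h + fromℕ n * (w * h)                   ≈⟨ +-cong (+-congʳ (+-congʳ hx≈ε)) (*-congˡ wh≈1-w) ⟩
      ε - h - fromℕ n * h + fromℕ n * (1# - w)                      ≤⟨ +-mono-≤ ≤-refl lowerˣ ⟩
      ε - h - fromℕ n * h + log x                                   ≈⟨ solve 4 (λ e h n l → e :- h :- n :* h :+ l
                                                                         := (con (+ 1) :+ n) :* (con (+ 1) :- (con (+ 1) :+ h)) :+ (l :+ e)) refl ε h (fromℕ n) (log x) ⟩
      fromℕ (suc n) * (1# - z) + (log x + ε)                        ≤⟨ +-monoˡ-≤ _ lowerʸ ⟩
      log y + (log x + ε)                                           ≈⟨ solve 3 (λ a b e → b :+ (a :+ e) := a :+ b :+ e) refl (log x) (log y) ε ⟩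
      log x + log y + ε                                             ∎
      where
      z = 1# + h
      0<z = +-positive 0<1 (<⇒≤ 0<h)
      w = z ⁻¹
      0<w = ⁻¹-positive 0<z
      wh≈1-w : w * h ≈ 1# - w
      wh≈1-w = begin-equality
        w * h               ≈⟨ solve 2 (λ w h → w :* h := (con (+ 1) :+ h) :* w :- w) refl w h ⟩
        z * w - w           ≈⟨ +-congʳ (⁻¹-inverse 0<z) ⟩
        1# - w              ∎
      lowerˣ : fromℕ n * (1# - w) ≤ log x
      lowerˣ = log-lower n 0<x 0<w (begin
        1#                ≈⟨ 1^n≈1 n ⟨
        1# ^ n            ≈⟨ ^-congˡ n (⁻¹-inverse 0<z) ⟨
        (z * w) ^ n       ≈⟨ ^-distrib-* z w n ⟩
        z ^ n * w ^ n     ≤⟨ *-mono-≤ (<⇒≤ (^-positive n 0<w)) (<⇒≤ 0<x) zⁿ≤x ≤-refl ⟩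
        x * w ^ n         ∎)
      lowerʸ : fromℕ (suc n) * (1# - z) ≤ log y
      lowerʸ = log-lower (suc n) 0<y 0<z (begin
        1#                ≈⟨ xy≈1 ⟨
        x * y             ≈⟨ *-comm x y ⟩
        y * x             ≤⟨ *-monoˡ-≤ y (<⇒≤ 0<y) x≤zⁿ⁺¹ ⟩
        y * z ^ suc n     ∎)

  log-⁻¹ : ∀ {x} → 0# < x → log x + log (x ⁻¹) ≈ 0#
  log-⁻¹ {x} 0<x = antisym
    (begin
      log x + log (x ⁻¹)   ≤⟨ log-superadditive 0<x 0<x⁻¹ ⟩
      log (x * x ⁻¹)       ≈⟨ log-cong (*-positive 0<x 0<x⁻¹) (⁻¹-inverse 0<x) ⟩
      log 1#               ≈⟨ log1≈0 ⟩
      0#                   ∎)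
    ([ (λ 1≤x → log-inverse-≥1 1≤x 0<x⁻¹ (⁻¹-inverse 0<x)) , x≤1⇒ ]′ (total 1# x))
    where
    0<x⁻¹ = ⁻¹-positive 0<x
    x≤1⇒ : x ≤ 1# → 0# ≤ log x + log (x ⁻¹)
    x≤1⇒ x≤1 = ≤-trans
      (log-inverse-≥1 1≤x⁻¹ 0<x (trans (*-comm _ _) (⁻¹-inverse 0<x)))
      (≤-reflexive (+-comm _ _))
      where
      1≤x⁻¹ : 1# ≤ x ⁻¹
      1≤x⁻¹ = *-cancelˡ-≤ x 0<x (begin
        x * 1#       ≈⟨ *-identityʳ x ⟩
        x            ≤⟨ x≤1 ⟩
        1#           ≈⟨ ⁻¹-inverse 0<x ⟨
        x * x ⁻¹     ∎)

  -- The upper half is superadditivity for x y and 1/y, whose product is x, combined with log (1/y)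
  -- = -log y.
  log-* : ∀ {x y} → 0# < x → 0# < y → log (x * y) ≈ log x + log y
  log-* {x} {y} 0<x 0<y = antisym
    (begin
      log (x * y)                               ≈⟨ +-identityʳ _ ⟨
      log (x * y) + 0#                          ≈⟨ +-congˡ (trans (+-comm _ _) (log-⁻¹ 0<y)) ⟨
      log (x * y) + (log (y ⁻¹) + log y)        ≈⟨ +-assoc _ _ _ ⟨
      log (x * y) + log (y ⁻¹) + log y          ≤⟨ +-monoˡ-≤ _ (log-superadditive 0<xy (⁻¹-positive 0<y)) ⟩
      log (x * y * y ⁻¹) + log y                ≈⟨ +-congʳ (log-cong (*-positive 0<xy (⁻¹-positive 0<y)) xyy⁻¹≈x) ⟩
      log x + log y                             ∎)
    (log-superadditive 0<x 0<y)
    where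
    0<xy = *-positive 0<x 0<y
    xyy⁻¹≈x : x * y * y ⁻¹ ≈ x
    xyy⁻¹≈x = trans (*-assoc _ _ _) (trans (*-congˡ (⁻¹-inverse 0<y)) (*-identityʳ x))

  log-^ : ∀ {x} n → 0# < x → log (x ^ n) ≈ fromℕ n * log x
  log-^ zero    0<x = trans log1≈0 (sym (zeroˡ _))
  log-^ {x} (suc n) 0<x = begin-equality
    log (x * x ^ n)              ≈⟨ log-* 0<x (^-positive n 0<x) ⟩
    log x + log (x ^ n)          ≈⟨ +-congˡ (log-^ n 0<x) ⟩
    log x + fromℕ n * log x      ≈⟨ solve 2 (λ n l → l :+ n :* l := (con (+ 1) :+ n) :* l) refl (fromℕ n) (log x) ⟩
    (1# + fromℕ n) * log x       ∎

  -- Monotonicity of the logarithm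

  1<x⇒0<log : ∀ {x} → 1# < x → 0# < log x
  1<x⇒0<log {x} 1<x = begin-strict
    0#             <⟨ ≰⇒> (λ 1-x⁻¹≤0 → <⇒≱ 1<x (≤-by (x * - (1# - x ⁻¹)) (*-nonNegative (<⇒≤ 0<x) (0≤- 1-x⁻¹≤0)) (begin-equality
                         x * - (1# - x ⁻¹) + x     ≈⟨ solve 2 (λ x i → x :* :- (con (+ 1) :- i) :+ x := x :* i) refl x (x ⁻¹) ⟩
                         x * x ⁻¹                  ≈⟨ ⁻¹-inverse 0<x ⟩
                         1#                        ∎))) ⟩
    1# - x ⁻¹      ≤⟨ 1-x⁻¹≤log 0<x ⟩
    log x          ∎
    where
    0<x = <-trans 0<1 1<x
    0≤- : ∀ {a} → a ≤ 0# → 0# ≤ - a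
    0≤- {a} a≤0 = ≤-trans (x≤y⇒0≤y-x a≤0) (≤-reflexive (+-identityˡ (- a)))

  log-mono-< : ∀ {x y} → 0# < x → x < y → log x < log y
  log-mono-< {x} {y} 0<x x<y = begin-strict
    log x                       <⟨ <-by _ (1<x⇒0<log 1<y/x) refl ⟩
    log (y / x) + log x         ≈⟨ log-* 0<y/x 0<x ⟨
    log (y / x * x)             ≈⟨ log-cong (*-positive 0<y/x 0<x) y/x*x≈y ⟩
    log y                       ∎
    where
    0<y/x = *-positive (<-trans 0<x x<y) (⁻¹-positive 0<x)
    y/x*x≈y : y / x * x ≈ y
    y/x*x≈y = trans (*-assoc _ _ _) (trans (*-congˡ (trans (*-comm _ _) (⁻¹-inverse 0<x))) (*-identityʳ y))
    1<y/x : 1# < y / x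
    1<y/x = begin-strict
      1#         ≈⟨ ⁻¹-inverse 0<x ⟨
      x * x ⁻¹   ≈⟨ *-comm _ _ ⟩
      x ⁻¹ * x   <⟨ *-monoˡ-< (x ⁻¹) (⁻¹-positive 0<x) x<y ⟩
      x ⁻¹ * y   ≈⟨ *-comm _ _ ⟩
      y / x      ∎

  log-cancel-≤ : ∀ {x y} → 0# < y → log x ≤ log y → x ≤ y
  log-cancel-≤ 0<y logx≤logy = ≮⇒≥ λ y<x → <⇒≱ (log-mono-< 0<y y<x) logx≤logy

  log-injective : ∀ {x y} → 0# < x → 0# < y → log x ≈ log y → x ≈ y
  log-injective 0<x 0<y eq = antisym (log-cancel-≤ 0<y (≤-reflexive eq)) (log-cancel-≤ 0<x (≤-reflexive (sym eq)))

  log-mono-≤ : ∀ {x y} → 0# < x → x ≤ y → log x ≤ log y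
  log-mono-≤ {x} {y} 0<x x≤y with x ≟ y
  ... | yes x≈y = ≤-reflexive (log-cong 0<x x≈y)
  ... | no  x≉y = <⇒≤ (log-mono-< 0<x (x≤y , x≉y))

  -- The exponential function

  -- The conclusion is a stable inequality, so the side conditions of `sup` may be doubly negated,
  -- which is the form in which the Archimedean property delivers them.
  sup-upper-¬¬ : ∀ P → ¬ ¬ Satisfiable P → ¬ ¬ Satisfiable (UpperBound P) → UpperBound P (sup P)
  sup-upper-¬¬ P ¬¬sat ¬¬bounded x Px = ≤-stable λ x≰sup →
    ¬¬sat λ sat → ¬¬bounded λ bounded → x≰sup (sup-upper P sat bounded x Px)

  sup-least-¬¬ : ∀ P → ¬ ¬ Satisfiable P → ∀ u → UpperBound P u → sup P ≤ u
  sup-least-¬¬ P ¬¬sat u P≤u = ≤-stable λ sup≰u → ¬¬sat λ sat → sup≰u (sup-least P sat u P≤u)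

  ExpBelow : Carrier → Pred Carrier 0ℓ
  ExpBelow ℓ z = 0# < z × log z ≤ ℓ

  exp : Carrier → Carrier
  exp ℓ = sup (ExpBelow ℓ)

  0<log2 : 0# < log 2#
  0<log2 = 1<x⇒0<log (<-by 1# 0<1 refl)

  -- Since log 2 > 0, powers of `½` have arbitrarily negative logarithms; in the same way powers of
  -- `2#` bound the set from above.
  expBelow-sat : ∀ ℓ → ¬ ¬ Satisfiable (ExpBelow ℓ)
  expBelow-sat ℓ none = archimedean-* (- ℓ) 0<log2 λ { (n , -ℓ<) → none (½ ^ n , ^-positive n 0<½ , (begin
    log (½ ^ n)                       ≈⟨ log-^ n 0<½ ⟩
    fromℕ n * log ½                   ≈⟨ solve 3 (λ n a b → n :* b := n :* (a :+ b) :- n :* a) refl (fromℕ n) (log 2#) (log ½) ⟩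
    fromℕ n * (log 2# + log ½) - fromℕ n * log 2#
                                      ≈⟨ +-congʳ (*-congˡ (log-⁻¹ 0<2)) ⟩
    fromℕ n * 0# - fromℕ n * log 2#   ≤⟨ ≤-by (fromℕ n * log 2# - - ℓ) (x≤y⇒0≤y-x (<⇒≤ -ℓ<))
                                           (solve 3 (λ n a l → n :* a :- :- l :+ (n :* con (+ 0) :- n :* a) := l) refl (fromℕ n) (log 2#) ℓ) ⟩
    ℓ                                 ∎)) }

  expBelow-bounded : ∀ ℓ → ¬ ¬ Satisfiable (UpperBound (ExpBelow ℓ))
  expBelow-bounded ℓ none = archimedean-* ℓ 0<log2 λ { (n , ℓ<) → none (2# ^ n , λ { z (0<z , logz≤ℓ) →
    log-cancel-≤ (^-positive n 0<2) (begin
      log z                ≤⟨ logz≤ℓ ⟩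
      ℓ                    ≤⟨ <⇒≤ ℓ< ⟩
      fromℕ n * log 2#     ≈⟨ log-^ n 0<2 ⟨
      log (2# ^ n)         ∎) }) }

  expBelow⇒≤exp : ∀ {ℓ z} → 0# < z → log z ≤ ℓ → z ≤ exp ℓ
  expBelow⇒≤exp {ℓ} 0<z logz≤ℓ = sup-upper-¬¬ (ExpBelow ℓ) (expBelow-sat ℓ) (expBelow-bounded ℓ) _ (0<z , logz≤ℓ)

  0<exp : ∀ ℓ → 0# < exp ℓ
  0<exp ℓ = ≰⇒> λ exp≤0 → expBelow-sat ℓ λ { (z , 0<z , logz≤ℓ) → <⇒≱ 0<z (≤-trans (expBelow⇒≤exp 0<z logz≤ℓ) exp≤0) }

  -- log is within ε of its value at y on the interval from y / (1 + ε) to y (1 + ε).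
  log-exp : ∀ ℓ → log (exp ℓ) ≈ ℓ
  log-exp ℓ = antisym (≮⇒≥ above) (≮⇒≥ below)
    where
    y = exp ℓ
    0<y = 0<exp ℓ
    module _ {ε} (0<ε : 0# < ε) where
      0<1+ε : 0# < 1# + ε
      0<1+ε = +-positive 0<1 (<⇒≤ 0<ε)
      y<y[1+ε] : y < y * (1# + ε)
      y<y[1+ε] = <-by (y * ε) (*-positive 0<y 0<ε) (solve 2 (λ y e → y :* e :+ y := y :* (con (+ 1) :+ e)) refl y ε)
      log[1+ε]≤ε : log (1# + ε) ≤ ε
      log[1+ε]≤ε = ≤-trans (log≤x-1 0<1+ε) (≤-reflexive (solve 1 (λ e → con (+ 1) :+ e :- con (+ 1) := e) refl ε))
    below : ¬ (log y < ℓ)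
    -- For ε = ℓ - log y the larger number y (1 + ε) would still belong to `ExpBelow ℓ`.
    below logy<ℓ = <⇒≱ (y<y[1+ε] 0<ε) (expBelow⇒≤exp (*-positive 0<y (0<1+ε 0<ε)) (begin
      log (y * (1# + ε))        ≈⟨ log-* 0<y (0<1+ε 0<ε) ⟩
      log y + log (1# + ε)      ≤⟨ +-mono-≤ ≤-refl (log[1+ε]≤ε 0<ε) ⟩
      log y + (ℓ - log y)       ≈⟨ solve 2 (λ a l → a :+ (l :- a) := l) refl (log y) ℓ ⟩
      ℓ                         ∎))
      where
      ε = ℓ - log y
      0<ε = x<y⇒0<y-x logy<ℓ
    above : ¬ (ℓ < log y)
    -- For ε = log y - ℓ the smaller number y / (1 + ε) would already be an upper bound of
    -- `ExpBelow ℓ`.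
    above ℓ<logy = <⇒≱ (y<y[1+ε] 0<ε) (begin
      y * (1# + ε)              ≤⟨ *-mono-≤ (<⇒≤ (0<1+ε 0<ε)) (<⇒≤ 0<yw) y≤yw ≤-refl ⟩
      y * w * (1# + ε)          ≈⟨ solve 3 (λ y w e → y :* w :* e := y :* (e :* w)) refl y w (1# + ε) ⟩
      y * ((1# + ε) * w)        ≈⟨ *-congˡ (⁻¹-inverse (0<1+ε 0<ε)) ⟩
      y * 1#                    ≈⟨ *-identityʳ y ⟩
      y                         ∎)
      where
      ε = log y - ℓ
      0<ε = x<y⇒0<y-x ℓ<logy
      w = (1# + ε) ⁻¹
      0<w = ⁻¹-positive (0<1+ε 0<ε)
      0<yw = *-positive 0<y 0<w
      y≤yw : y ≤ y * w
      y≤yw = sup-least-¬¬ _ (expBelow-sat ℓ) (y * w) λ { z (0<z , logz≤ℓ) → log-cancel-≤ 0<yw (begin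
        log z                                 ≤⟨ logz≤ℓ ⟩
        ℓ                                     ≈⟨ solve 2 (λ a l → l := a :- (a :- l)) refl (log y) ℓ ⟩
        log y - ε                             ≤⟨ ≤-by (ε - log (1# + ε)) (x≤y⇒0≤y-x (log[1+ε]≤ε 0<ε))
                                                   (solve 3 (λ e l a → e :- l :+ (a :- e) := a :- l) refl ε (log (1# + ε)) (log y)) ⟩
        log y - log (1# + ε)                  ≈⟨ solve 3 (λ a l m → a :- l := a :+ m :- (l :+ m)) refl (log y) (log (1# + ε)) (log w) ⟩
        log y + log w - (log (1# + ε) + log w) ≈⟨ +-congˡ (-‿cong (log-⁻¹ (0<1+ε 0<ε))) ⟩
        log y + log w - 0#                    ≈⟨ solve 1 (λ a → a :- con (+ 0) := a) refl _ ⟩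
        log y + log w                         ≈⟨ log-* 0<y 0<w ⟨
        log (y * w)                           ∎) }

  -- Equality in the tangent bound for the logarithm

  x²≤0⇒x≈0 : ∀ {x} → x * x ≤ 0# → x ≈ 0#
  x²≤0⇒x≈0 {x} x²≤0 with x ≟ 0#
  ... | yes x≈0 = x≈0
  ... | no  x≉0 = *-cancelˡ-≈ x x≉0 (trans (antisym x²≤0 (0≤x² x)) (sym (zeroʳ x)))

  x-y≈0⇒x≈y : ∀ {x y} → x - y ≈ 0# → x ≈ y
  x-y≈0⇒x≈y {x} {y} x-y≈0 = begin-equality
    x            ≈⟨ solve 2 (λ x y → x := x :- y :+ y) refl x y ⟩
    x - y + y    ≈⟨ +-congʳ x-y≈0 ⟩
    0# + y       ≈⟨ +-identityˡ y ⟩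
    y            ∎

  -- With s = √x: x - 1 ≤ 2 log s ≤ 2 (s - 1), that is, (s - 1)² ≤ 0.
  x-1≤log⇒x≈1 : ∀ {x} → 0# < x → x - 1# ≤ log x → x ≈ 1#
  x-1≤log⇒x≈1 {x} 0<x x-1≤logx = begin-equality
    x          ≈⟨ s²≈x ⟨
    s * s      ≈⟨ *-cong s≈1 s≈1 ⟩
    1# * 1#    ≈⟨ *-identityˡ 1# ⟩
    1#         ∎
    where
    s = exp (½ * log x)
    0<s = 0<exp (½ * log x)
    2logs : log s + log s ≈ log x
    2logs = begin-equality
      log s + log s              ≈⟨ solve 1 (λ l → l :+ l := con (+ 2) :* l) refl (log s) ⟩
      2# * log s                 ≈⟨ *-congˡ (log-exp _) ⟩
      2# * (½ * log x)           ≈⟨ 2*½* (log x) ⟩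
      log x                      ∎
    s²≈x : s * s ≈ x
    s²≈x = log-injective (*-positive 0<s 0<s) 0<x (trans (log-* 0<s 0<s) 2logs)
    s≈1 : s ≈ 1#
    s≈1 = x-y≈0⇒x≈y (x²≤0⇒x≈0 (begin
      (s - 1#) * (s - 1#)                        ≈⟨ solve 1 (λ s → (s :- con (+ 1)) :* (s :- con (+ 1)) := s :* s :- con (+ 1) :- con (+ 2) :* (s :- con (+ 1))) refl s ⟩
      s * s - 1# - 2# * (s - 1#)                 ≈⟨ +-congʳ (+-congʳ s²≈x) ⟩
      x - 1# - 2# * (s - 1#)                     ≤⟨ +-monoˡ-≤ _ x-1≤logx ⟩
      log x - 2# * (s - 1#)                      ≈⟨ +-congʳ 2logs ⟨
      log s + log s - 2# * (s - 1#)              ≤⟨ +-monoˡ-≤ _ (+-mono-≤ (log≤x-1 0<s) (log≤x-1 0<s)) ⟩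
      s - 1# + (s - 1#) - 2# * (s - 1#)          ≈⟨ solve 1 (λ s → s :- con (+ 1) :+ (s :- con (+ 1)) :- con (+ 2) :* (s :- con (+ 1)) := con (+ 0)) refl s ⟩
      0#                                         ∎))

  -- Real powers as exponentials

  fromℕ-0 : ∀ x → x - fromℕ 0 ≈ x
  fromℕ-0 = solve 1 (λ x → x :- con (+ 0) := x) refl

  module _ {x p} (1≤x : 1# ≤ x) (0≤p : 0# ≤ p) where
    private
      0<x : 0# < x
      0<x = 1≤x⇒0<x 1≤x
      ℓ = log x
      e = exp (p * ℓ)
      0<e = 0<exp (p * ℓ)

      one : RationalPowersBelow x p 1#
      one = 0<1 , 0 , 1 , 0 , ℕ.z<s ,
        (begin
          0# - 0#              ≈⟨ -‿inverseʳ 0# ⟩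
          0#                   ≤⟨ *-nonNegative 0≤p (0≤fromℕ 1) ⟩
          p * fromℕ 1          ∎) ,
        trans (*-identityʳ _) (1^n≈1 1)

      -- Logarithms turn the defining equation of z into b log z = (a - c) ℓ. Comparing a - c with p
      -- b then uses ℓ ≥ 0, which is where 1 ≤ x enters.
      upper : UpperBound (RationalPowersBelow x p) e
      upper z (0<z , a , b , c , 0<b , a-c≤pb , zᵇxᶜ≈xᵃ) = log-cancel-≤ 0<e (*-cancelˡ-≤ (fromℕ b) (0<fromℕ 0<b) (begin
        fromℕ b * log z                                    ≈⟨ solve 2 (λ u v → u := u :+ v :- v) refl (fromℕ b * log z) (fromℕ c * ℓ) ⟩
        fromℕ b * log z + fromℕ c * ℓ - fromℕ c * ℓ        ≈⟨ +-congʳ (+-cong (log-^ b 0<z) (log-^ c 0<x)) ⟨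
        log (z ^ b) + log (x ^ c) - fromℕ c * ℓ            ≈⟨ +-congʳ (log-* (^-positive b 0<z) (^-positive c 0<x)) ⟨
        log (z ^ b * x ^ c) - fromℕ c * ℓ                  ≈⟨ +-congʳ (log-cong (*-positive (^-positive b 0<z) (^-positive c 0<x)) zᵇxᶜ≈xᵃ) ⟩
        log (x ^ a) - fromℕ c * ℓ                          ≈⟨ +-congʳ (log-^ a 0<x) ⟩
        fromℕ a * ℓ - fromℕ c * ℓ                          ≈⟨ solve 3 (λ a c l → a :* l :- c :* l := l :* (a :- c)) refl (fromℕ a) (fromℕ c) ℓ ⟩
        ℓ * (fromℕ a - fromℕ c)                            ≤⟨ *-monoˡ-≤ ℓ (1≤x⇒0≤log 1≤x) a-c≤pb ⟩
        ℓ * (p * fromℕ b)                                  ≈⟨ solve 3 (λ l p b → l :* (p :* b) := b :* (p :* l)) refl ℓ p (fromℕ b) ⟩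
        fromℕ b * (p * ℓ)                                  ≈⟨ *-congˡ (log-exp (p * ℓ)) ⟨
        fromℕ b * log e                                    ∎))

      -- If log u < p log x, some x ^ (a / b) with p - 1/b < a / b ≤ p exceeds u.
      least : ∀ u → UpperBound (RationalPowersBelow x p) u → e ≤ u
      least u ≤u = ≮⇒≥ λ u<e →
        let logu<pℓ = <-respʳ-≈ (log-exp (p * ℓ)) (log-mono-< 0<u u<e)
        in archimedean-* ℓ (x<y⇒0<y-x logu<pℓ) λ { (b , ℓ<bδ) →
             archimedean (p * fromℕ b) λ { (n , pb<n) →
               let a , a≤pb , 1+a≰pb = crossing (λ a → fromℕ a ≤? p * fromℕ b) (*-nonNegative 0≤p (0≤fromℕ b)) n (<⇒≱ pb<n)
               in contra a b a≤pb (<⇒≤ (≰⇒> 1+a≰pb)) ℓ<bδ } }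
        where
        0<u : 0# < u
        0<u = begin-strict 0# <⟨ 0<1 ⟩ 1# ≤⟨ ≤u 1# one ⟩ u ∎
        -- Let δ = p ℓ - log u. Since z = x ^ (a / b) is at most u, b log u ≥ a ℓ, so b δ ≤ (a + 1)
        -- ℓ - a ℓ = ℓ, against the choice of b.
        contra : ∀ a b → fromℕ a ≤ p * fromℕ b → p * fromℕ b ≤ fromℕ (suc a) → ¬ (ℓ < fromℕ b * (p * ℓ - log u))
        -- The Archimedean choice of b could be 0, but then it would say ℓ < 0.
        contra a zero a≤pb pb≤1+a ℓ<0 = <⇒≱ ℓ<0 (≤-trans (≤-reflexive (zeroˡ _)) (1≤x⇒0≤log 1≤x))
        contra a b@(suc _) a≤pb pb≤1+a ℓ<bδ = <⇒≱ ℓ<bδ (begin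
          B * (p * ℓ - log u)                       ≈⟨ solve 4 (λ B p l m → B :* (p :* l :- m) := l :* (p :* B) :- B :* m) refl B p ℓ (log u) ⟩
          ℓ * (p * B) - B * log u                   ≤⟨ +-monoˡ-≤ _ (*-monoˡ-≤ ℓ (1≤x⇒0≤log 1≤x) pb≤1+a) ⟩
          ℓ * (1# + fromℕ a) - B * log u            ≤⟨ ≤-by (B * log u - B * log z) (x≤y⇒0≤y-x (*-monoˡ-≤ B (<⇒≤ 0<B) (log-mono-≤ 0<z z≤u)))
                                                         (solve 4 (λ l a u z → u :- z :+ (l :* (con (+ 1) :+ a) :- u) := l :+ (a :* l :- z)) refl ℓ (fromℕ a) (B * log u) (B * log z)) ⟩
          ℓ + (fromℕ a * ℓ - B * log z)             ≈⟨ +-congˡ (+-congˡ (-‿cong B*logz)) ⟩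
          ℓ + (fromℕ a * ℓ - fromℕ a * ℓ)           ≈⟨ solve 2 (λ l m → l :+ (m :- m) := l) refl ℓ (fromℕ a * ℓ) ⟩
          ℓ                                         ∎)
          where
          B = fromℕ b
          0<B : 0# < B
          0<B = 0<fromℕ {b} ℕ.z<s
          -- Here `exp` supplies the b-th root of x ^ a.
          z = exp (fromℕ a * ℓ / B)
          0<z : 0# < z
          0<z = 0<exp (fromℕ a * ℓ / B)
          B*logz : B * log z ≈ fromℕ a * ℓ
          B*logz = begin-equality
            B * log z                    ≈⟨ *-congˡ (log-exp _) ⟩
            B * (fromℕ a * ℓ / B)        ≈⟨ solve 3 (λ B m i → B :* (m :* i) := (B :* i) :* m) refl B (fromℕ a * ℓ) (B ⁻¹) ⟩
            B * B ⁻¹ * (fromℕ a * ℓ)     ≈⟨ *-congʳ (⁻¹-inverse 0<B) ⟩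
            1# * (fromℕ a * ℓ)           ≈⟨ *-identityˡ _ ⟩
            fromℕ a * ℓ                  ∎
          z≤u : z ≤ u
          z≤u = ≤u z (0<z , a , b , 0 , ℕ.z<s , ≤-trans (≤-reflexive (fromℕ-0 _)) a≤pb ,
            trans (*-identityʳ _) (log-injective (^-positive b 0<z) (^-positive a 0<x)
              (trans (log-^ b 0<z) (trans B*logz (sym (log-^ a 0<x))))))

    sup≈exp : sup (RationalPowersBelow x p) ≈ exp (p * log x)
    sup≈exp = antisym
      (sup-least _ (1# , one) e upper)
      (least _ (sup-upper _ (1# , one) (e , upper)))

  ≈exp⇒log≈ : ∀ {x ℓ} → x ≈ exp ℓ → 0# < x × log x ≈ ℓ
  ≈exp⇒log≈ {x} {ℓ} x≈ = 0<x , trans (log-cong 0<x x≈) (log-exp ℓ)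
    where
    0<x : 0# < x
    0<x = <-respʳ-≈ (sym x≈) (0<exp ℓ)

  -- The single access to the definition of powers of positive bases. Positivity is proved along
  -- with the formula so that `log-injective` can turn identities of logarithms into identities of
  -- powers. For x < 1 the two reciprocals in the definition change the sign of the logarithm twice.
  ^ʳ-log : ∀ {x p} → 0# < x → 0# ≤ p → 0# < x ^ʳ p × log (x ^ʳ p) ≈ p * log x
  ^ʳ-log {x} {p} 0<x 0≤p with x ≤? 0#
  ... | yes x≤0 = contradiction x≤0 (<⇒≱ 0<x)
  ... | no  _ with 1# ≤? x
  ...   | yes 1≤x = ≈exp⇒log≈ (sup≈exp 1≤x 0≤p)
  ...   | no  1≰x = ⁻¹-positive 0<y , (begin-equality
          log (y ⁻¹)                             ≈⟨ solve 2 (λ a b → b := a :+ b :- a) refl (log y) (log (y ⁻¹)) ⟩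
          log y + log (y ⁻¹) - log y             ≈⟨ +-cong (log-⁻¹ 0<y) (-‿cong logy) ⟩
          0# - p * log (x ⁻¹)                    ≈⟨ solve 3 (λ p a b → con (+ 0) :- p :* b := p :* a :- p :* (a :+ b)) refl p (log x) (log (x ⁻¹)) ⟩
          p * log x - p * (log x + log (x ⁻¹))   ≈⟨ +-congˡ (-‿cong (*-congˡ (log-⁻¹ 0<x))) ⟩
          p * log x - p * 0#                     ≈⟨ solve 2 (λ a p → a :- p :* con (+ 0) := a) refl (p * log x) p ⟩
          p * log x                              ∎)
          where
          y = sup (RationalPowersBelow (x ⁻¹) p)
          1≤x⁻¹ : 1# ≤ x ⁻¹
          1≤x⁻¹ = *-cancelˡ-≤ x 0<x (begin
            x * 1#       ≈⟨ *-identityʳ x ⟩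
            x            ≤⟨ <⇒≤ (≰⇒> 1≰x) ⟩
            1#           ≈⟨ ⁻¹-inverse 0<x ⟨
            x * x ⁻¹     ∎)
          0<y×logy = ≈exp⇒log≈ (sup≈exp 1≤x⁻¹ 0≤p)
          0<y = proj₁ 0<y×logy
          logy = proj₂ 0<y×logy

  -- Laws of real powers

  ^ʳ-positive : ∀ {x p} → 0# < x → 0# ≤ p → 0# < x ^ʳ p
  ^ʳ-positive 0<x 0≤p = proj₁ (^ʳ-log 0<x 0≤p)

  log-^ʳ : ∀ {x p} → 0# < x → 0# ≤ p → log (x ^ʳ p) ≈ p * log x
  log-^ʳ 0<x 0≤p = proj₂ (^ʳ-log 0<x 0≤p)

  0^ʳ : ∀ {x p} → x ≈ 0# → 0# < p → x ^ʳ p ≈ 0#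
  0^ʳ {x} {p} x≈0 0<p with x ≤? 0#
  ... | no  x≰0 = contradiction (≤-reflexive x≈0) x≰0
  ... | yes _ with p ≟ 0#
  ...   | yes p≈0 = contradiction p≈0 (0<⇒≉0 0<p)
  ...   | no  _   = refl

  0≤⇒≈0⊎0< : ∀ {x} → 0# ≤ x → x ≈ 0# ⊎ 0# < x
  0≤⇒≈0⊎0< {x} 0≤x with x ≟ 0#
  ... | yes x≈0 = inj₁ x≈0
  ... | no  x≉0 = inj₂ (0≤x , x≉0 ∘ sym)

  ^ʳ-nonNegative : ∀ {x p} → 0# ≤ x → 0# < p → 0# ≤ x ^ʳ p
  ^ʳ-nonNegative 0≤x 0<p with 0≤⇒≈0⊎0< 0≤x
  ... | inj₁ x≈0 = ≤-reflexive (sym (0^ʳ x≈0 0<p))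
  ... | inj₂ 0<x = <⇒≤ (^ʳ-positive 0<x (<⇒≤ 0<p))

  -- No axiom makes `sup` respect equivalence of predicates, and the definition also branches on its
  -- arguments. Comparing logarithms settles both at once.
  ^ʳ-cong : ∀ {x y p q} → 0# ≤ x → 0# < p → x ≈ y → p ≈ q → x ^ʳ p ≈ y ^ʳ q
  ^ʳ-cong {x} {y} {p} {q} 0≤x 0<p x≈y p≈q with 0≤⇒≈0⊎0< 0≤x
  ... | inj₁ x≈0 = trans (0^ʳ x≈0 0<p) (sym (0^ʳ (trans (sym x≈y) x≈0) (<-respʳ-≈ p≈q 0<p)))
  ... | inj₂ 0<x = log-injective (^ʳ-positive 0<x 0≤p) (^ʳ-positive 0<y 0≤q) (begin-equality
    log (x ^ʳ p)    ≈⟨ log-^ʳ 0<x 0≤p ⟩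
    p * log x       ≈⟨ *-cong p≈q (log-cong 0<x x≈y) ⟩
    q * log y       ≈⟨ log-^ʳ 0<y 0≤q ⟨
    log (y ^ʳ q)    ∎)
    where
    0<y = <-respʳ-≈ x≈y 0<x
    0≤p = <⇒≤ 0<p
    0≤q = ≤-trans 0≤p (≤-reflexive p≈q)

  ^ʳ-identityʳ : ∀ {x} → 0# ≤ x → x ^ʳ 1# ≈ x
  ^ʳ-identityʳ {x} 0≤x with 0≤⇒≈0⊎0< 0≤x
  ... | inj₁ x≈0 = trans (0^ʳ x≈0 0<1) (sym x≈0)
  ... | inj₂ 0<x = log-injective (^ʳ-positive 0<x (<⇒≤ 0<1)) 0<x
                     (trans (log-^ʳ 0<x (<⇒≤ 0<1)) (*-identityˡ _))

  ^ʳ-assocʳ : ∀ {x p q} → 0# ≤ x → 0# < p → 0# < q → (x ^ʳ p) ^ʳ q ≈ x ^ʳ (p * q)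
  ^ʳ-assocʳ {x} {p} {q} 0≤x 0<p 0<q with 0≤⇒≈0⊎0< 0≤x
  ... | inj₁ x≈0 = trans (0^ʳ (0^ʳ x≈0 0<p) 0<q) (sym (0^ʳ x≈0 (*-positive 0<p 0<q)))
  ... | inj₂ 0<x = log-injective (^ʳ-positive 0<xᵖ 0≤q) (^ʳ-positive 0<x 0≤pq) (begin-equality
    log ((x ^ʳ p) ^ʳ q)    ≈⟨ log-^ʳ 0<xᵖ 0≤q ⟩
    q * log (x ^ʳ p)       ≈⟨ *-congˡ (log-^ʳ 0<x 0≤p) ⟩
    q * (p * log x)        ≈⟨ solve 3 (λ p q l → q :* (p :* l) := p :* q :* l) refl p q (log x) ⟩
    p * q * log x          ≈⟨ log-^ʳ 0<x 0≤pq ⟨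
    log (x ^ʳ (p * q))     ∎)
    where
    0≤p = <⇒≤ 0<p
    0≤q = <⇒≤ 0<q
    0≤pq = *-nonNegative 0≤p 0≤q
    0<xᵖ = ^ʳ-positive 0<x 0≤p

  ^ʳ-distrib-* : ∀ {x y p} → 0# ≤ x → 0# ≤ y → 0# < p → (x * y) ^ʳ p ≈ x ^ʳ p * y ^ʳ p
  ^ʳ-distrib-* {x} {y} {p} 0≤x 0≤y 0<p with 0≤⇒≈0⊎0< 0≤x | 0≤⇒≈0⊎0< 0≤y
  ... | inj₁ x≈0 | _        = trans (0^ʳ (trans (*-congʳ x≈0) (zeroˡ y)) 0<p) (sym (trans (*-congʳ (0^ʳ x≈0 0<p)) (zeroˡ _)))
  ... | inj₂ _   | inj₁ y≈0 = trans (0^ʳ (trans (*-congˡ y≈0) (zeroʳ x)) 0<p) (sym (trans (*-congˡ (0^ʳ y≈0 0<p)) (zeroʳ _)))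
  ... | inj₂ 0<x | inj₂ 0<y = log-injective (^ʳ-positive 0<xy 0≤p) (*-positive 0<xᵖ 0<yᵖ) (begin-equality
    log ((x * y) ^ʳ p)               ≈⟨ log-^ʳ 0<xy 0≤p ⟩
    p * log (x * y)                  ≈⟨ *-congˡ (log-* 0<x 0<y) ⟩
    p * (log x + log y)              ≈⟨ distribˡ p _ _ ⟩
    p * log x + p * log y            ≈⟨ +-cong (log-^ʳ 0<x 0≤p) (log-^ʳ 0<y 0≤p) ⟨
    log (x ^ʳ p) + log (y ^ʳ p)      ≈⟨ log-* 0<xᵖ 0<yᵖ ⟨
    log (x ^ʳ p * y ^ʳ p)            ∎)
    where
    0≤p = <⇒≤ 0<p
    0<xy = *-positive 0<x 0<y
    0<xᵖ = ^ʳ-positive 0<x 0≤p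
    0<yᵖ = ^ʳ-positive 0<y 0≤p

  ^ʳ-inverse : ∀ {x p q} → 0# ≤ x → 0# < p → 0# < q → p * q ≈ 1# → (x ^ʳ p) ^ʳ q ≈ x
  ^ʳ-inverse 0≤x 0<p 0<q pq≈1 = trans (^ʳ-assocʳ 0≤x 0<p 0<q)
    (trans (^ʳ-cong 0≤x (*-positive 0<p 0<q) refl pq≈1) (^ʳ-identityʳ 0≤x))

  ^ʳ-conjugate : ∀ {x r} → 0# < x → 0# ≤ r → r ≤ 1# → x ^ʳ (1# - r) * x ^ʳ r ≈ x
  ^ʳ-conjugate {x} {r} 0<x 0≤r r≤1 = log-injective (*-positive 0<a 0<b) 0<x (begin-equality
    log (x ^ʳ (1# - r) * x ^ʳ r)              ≈⟨ log-* 0<a 0<b ⟩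
    log (x ^ʳ (1# - r)) + log (x ^ʳ r)        ≈⟨ +-cong (log-^ʳ 0<x 0≤1-r) (log-^ʳ 0<x 0≤r) ⟩
    (1# - r) * log x + r * log x              ≈⟨ solve 2 (λ r l → (con (+ 1) :- r) :* l :+ r :* l := l) refl r (log x) ⟩
    log x                                     ∎)
    where
    0≤1-r = x≤y⇒0≤y-x r≤1
    0<a = ^ʳ-positive 0<x 0≤1-r
    0<b = ^ʳ-positive 0<x 0≤r

  -- Weighted AM-GM inequality with its equality case

  module _ {a b r} (0<a : 0# < a) (0<b : 0# < b) (0<r : 0# < r) (r≤1 : r ≤ 1#) where
    private
      0≤r = <⇒≤ 0<r
      0≤1-r = x≤y⇒0≤y-x r≤1
      c = r * a + (1# - r) * b
      0<c = +-positive (*-positive 0<r 0<a) (*-nonNegative 0≤1-r (<⇒≤ 0<b))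
      i = c ⁻¹
      0<i = ⁻¹-positive 0<c
      aʳ = a ^ʳ r
      b¹⁻ʳ = b ^ʳ (1# - r)
      0<aʳ = ^ʳ-positive 0<a 0≤r
      0<b¹⁻ʳ = ^ʳ-positive 0<b 0≤1-r

      defect : Carrier → Carrier
      defect t = t - 1# - log t

      0≤defect : ∀ {t} → 0# < t → 0# ≤ defect t
      0≤defect 0<t = x≤y⇒0≤y-x (log≤x-1 0<t)

      -- Dividing by the mean c makes the linear terms cancel, since r (a/c) + (1 - r) (b/c) = 1.
      -- The logarithmic gap in AM-GM is therefore exactly a weighted sum of slacks in log t ≤ t -
      -- 1: the slacks are nonnegative, and if they vanish with both weights positive, a/c and b/c
      -- are both 1.
      total-defect : r * defect (a * i) + (1# - r) * defect (b * i) + log (aʳ * b¹⁻ʳ) ≈ log c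
      total-defect = begin-equality
        r * defect (a * i) + (1# - r) * defect (b * i) + log (aʳ * b¹⁻ʳ)
          ≈⟨ +-cong (+-cong (*-congˡ (+-congˡ (-‿cong (log-* 0<a 0<i)))) (*-congˡ (+-congˡ (-‿cong (log-* 0<b 0<i)))))
               (trans (log-* 0<aʳ 0<b¹⁻ʳ) (+-cong (log-^ʳ 0<a 0≤r) (log-^ʳ 0<b 0≤1-r))) ⟩
        r * (a * i - 1# - (log a + log i)) + (1# - r) * (b * i - 1# - (log b + log i)) + (r * log a + (1# - r) * log b)
          ≈⟨ solve 7 (λ r a b i A B I →
               r :* (a :* i :- con (+ 1) :- (A :+ I)) :+ (con (+ 1) :- r) :* (b :* i :- con (+ 1) :- (B :+ I)) :+ (r :* A :+ (con (+ 1) :- r) :* B)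
               := (r :* a :+ (con (+ 1) :- r) :* b) :* i :- con (+ 1) :- I) refl r a b i (log a) (log b) (log i) ⟩
        c * i - 1# - log i            ≈⟨ +-congʳ (+-congʳ (⁻¹-inverse 0<c)) ⟩
        1# - 1# - log i               ≈⟨ solve 2 (λ C I → con (+ 1) :- con (+ 1) :- I := C :- (C :+ I)) refl (log c) (log i) ⟩
        log c - (log c + log i)       ≈⟨ +-congˡ (-‿cong (log-⁻¹ 0<c)) ⟩
        log c - 0#                    ≈⟨ solve 1 (λ C → C :- con (+ 0) := C) refl (log c) ⟩
        log c                         ∎

      0≤rd₁ = *-nonNegative 0≤r (0≤defect (*-positive 0<a 0<i))
      0≤sd₂ = *-nonNegative 0≤1-r (0≤defect (*-positive 0<b 0<i))

    weighted-am-gm⁺ : a ^ʳ r * b ^ʳ (1# - r) ≤ r * a + (1# - r) * b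
    weighted-am-gm⁺ = log-cancel-≤ 0<c (≤-by _ (+-nonNegative 0≤rd₁ 0≤sd₂) total-defect)

    weighted-am-gm-equality⁺ : r < 1# → r * a + (1# - r) * b ≤ a ^ʳ r * b ^ʳ (1# - r) → a ≈ b
    weighted-am-gm-equality⁺ r<1 c≤ = *-cancelˡ-≈ i (0<⇒≉0 0<i)
      (trans (*-comm i a) (trans ai≈1 (trans (sym bi≈1) (*-comm b i))))
      where
      D = r * defect (a * i) + (1# - r) * defect (b * i)
      D≤0 : D ≤ 0#
      D≤0 = begin
        D                                                   ≈⟨ solve 2 (λ d l → d := d :+ l :- l) refl D (log (aʳ * b¹⁻ʳ)) ⟩
        D + log (aʳ * b¹⁻ʳ) - log (aʳ * b¹⁻ʳ)               ≈⟨ +-congʳ total-defect ⟩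
        log c - log (aʳ * b¹⁻ʳ)                             ≤⟨ +-monoˡ-≤ _ (log-mono-≤ 0<c c≤) ⟩
        log (aʳ * b¹⁻ʳ) - log (aʳ * b¹⁻ʳ)                   ≈⟨ -‿inverseʳ _ ⟩
        0#                                                  ∎
      noDefect : ∀ {w t} → 0# < w → 0# < t → w * defect t ≤ 0# → t ≈ 1#
      noDefect {w} {t} 0<w 0<t wd≤0 = x-1≤log⇒x≈1 0<t (≤-by (0# - defect t)
        (x≤y⇒0≤y-x (*-cancelˡ-≤ w 0<w (≤-trans wd≤0 (≤-reflexive (sym (zeroʳ w))))))
        (solve 2 (λ t l → con (+ 0) :- (t :- con (+ 1) :- l) :+ (t :- con (+ 1)) := l) refl t (log t)))
      ai≈1 : a * i ≈ 1#
      ai≈1 = noDefect 0<r (*-positive 0<a 0<i) (≤-trans (≤-by _ 0≤sd₂ (+-comm _ _)) D≤0)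
      bi≈1 : b * i ≈ 1#
      bi≈1 = noDefect (x<y⇒0<y-x r<1) (*-positive 0<b 0<i) (≤-trans (≤-by _ 0≤rd₁ refl) D≤0)

  module _ {a b r} (0≤a : 0# ≤ a) (0<b : 0# < b) (0<r : 0# < r) (r≤1 : r ≤ 1#) where
    private
      zero-product : a ≈ 0# → a ^ʳ r * b ^ʳ (1# - r) ≈ 0#
      zero-product a≈0 = trans (*-congʳ (0^ʳ a≈0 0<r)) (zeroˡ _)

      mean≈ : a ≈ 0# → r * a + (1# - r) * b ≈ (1# - r) * b
      mean≈ a≈0 = trans (+-congʳ (trans (*-congˡ a≈0) (zeroʳ r))) (+-identityˡ _)

    weighted-am-gm : a ^ʳ r * b ^ʳ (1# - r) ≤ r * a + (1# - r) * b
    weighted-am-gm with 0≤⇒≈0⊎0< 0≤a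
    ... | inj₂ 0<a = weighted-am-gm⁺ 0<a 0<b 0<r r≤1
    ... | inj₁ a≈0 = begin
      a ^ʳ r * b ^ʳ (1# - r)    ≈⟨ zero-product a≈0 ⟩
      0#                        ≤⟨ *-nonNegative (x≤y⇒0≤y-x r≤1) (<⇒≤ 0<b) ⟩
      (1# - r) * b              ≈⟨ mean≈ a≈0 ⟨
      r * a + (1# - r) * b      ∎

    weighted-am-gm-equality : r < 1# → a ^ʳ r * b ^ʳ (1# - r) ≈ r * a + (1# - r) * b → a ≈ b
    weighted-am-gm-equality r<1 eq with 0≤⇒≈0⊎0< 0≤a
    ... | inj₂ 0<a = weighted-am-gm-equality⁺ 0<a 0<b 0<r r≤1 r<1 (≤-reflexive (sym eq))
    -- Equality cannot occur at a = 0: the product is 0, the mean is (1 - r) b > 0.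
    ... | inj₁ a≈0 = contradiction
      (trans (sym (mean≈ a≈0)) (trans (sym eq) (zero-product a≈0)))
      (0<⇒≉0 (*-positive (x<y⇒0<y-x r<1) 0<b))

  -- Finite sums

  sum-nonNegative : ∀ {k} {f : Fin k → Carrier} → (∀ i → 0# ≤ f i) → 0# ≤ sum f
  sum-nonNegative {zero}  0≤f = ≤-refl
  sum-nonNegative {suc k} 0≤f = +-nonNegative (0≤f zero) (sum-nonNegative (0≤f ∘ suc))

  sum-mono-≤ : ∀ {k} {f g : Fin k → Carrier} → (∀ i → f i ≤ g i) → sum f ≤ sum g
  sum-mono-≤ {zero}  f≤g = ≤-refl
  sum-mono-≤ {suc k} f≤g = +-mono-≤ (f≤g zero) (sum-mono-≤ (f≤g ∘ suc))

  -- The differences g i - f i are nonnegative with total at most 0, so none of them can be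
  -- positive.
  sum-≤-equality : ∀ {k} {f g : Fin k → Carrier} → (∀ i → f i ≤ g i) → sum g ≤ sum f → ∀ i → f i ≈ g i
  sum-≤-equality {suc k} {f} {g} f≤g Σg≤Σf zero = antisym (f≤g zero)
    (≤-by (sum f - sum g + (G - F)) (+-nonNegative (x≤y⇒0≤y-x Σg≤Σf) (x≤y⇒0≤y-x (sum-mono-≤ (f≤g ∘ suc))))
      (solve 4 (λ f F g G → f :+ F :- (g :+ G) :+ (G :- F) :+ g := f) refl (f zero) F (g zero) G))
    where
    F = sum (f ∘ suc)
    G = sum (g ∘ suc)
  sum-≤-equality {suc k} {f} {g} f≤g Σg≤Σf (suc i) = sum-≤-equality (f≤g ∘ suc)
    (≤-by (sum f - sum g + (g zero - f zero)) (+-nonNegative (x≤y⇒0≤y-x Σg≤Σf) (x≤y⇒0≤y-x (f≤g zero)))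
      (solve 4 (λ f F g G → f :+ F :- (g :+ G) :+ (g :- f) :+ G := F) refl (f zero) (sum (f ∘ suc)) (g zero) (sum (g ∘ suc))))
    i

  sum-affine : ∀ {k} r c (f : Fin k → Carrier) → sum (λ i → r * f i + c) ≈ r * sum f + fromℕ k * c
  sum-affine {zero}  r c f = solve 2 (λ r c → con (+ 0) := r :* con (+ 0) :+ con (+ 0) :* c) refl r c
  sum-affine {suc k} r c f = trans (+-congˡ (sum-affine r c (f ∘ suc)))
    (solve 5 (λ r c x s k → r :* x :+ c :+ (r :* s :+ k :* c) := r :* (x :+ s) :+ (con (+ 1) :+ k) :* c)
       refl r c (f zero) (sum (f ∘ suc)) (fromℕ k))

  sum-const : ∀ {k c} {f : Fin k → Carrier} → (∀ i → f i ≈ c) → sum f ≈ fromℕ k * c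
  sum-const {zero}  {c} f≈c = sym (zeroˡ c)
  sum-const {suc k} {c} f≈c = trans (+-cong (f≈c zero) (sum-const (f≈c ∘ suc)))
    (solve 2 (λ k c → c :+ k :* c := (con (+ 1) :+ k) :* c) refl (fromℕ k) c)

  sum≈0⇒≈0 : ∀ {k} {f : Fin k → Carrier} → (∀ i → 0# ≤ f i) → sum f ≈ 0# → ∀ i → f i ≈ 0#
  sum≈0⇒≈0 {k} 0≤f Σf≈0 i = sym (sum-≤-equality 0≤f
    (≤-reflexive (trans Σf≈0 (sym (trans (sum-const {k} (λ _ → refl)) (zeroʳ _))))) i)

  -- Power mean inequality

  module PowerMean {k} (a : Fin k → Carrier) {r} (0≤a : ∀ i → 0# ≤ a i) (0<r : 0# < r) (r≤1 : r ≤ 1#) where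

    private
      S = sum a
      0≤S = sum-nonNegative 0≤a
      Σaʳ = sum (λ i → a i ^ʳ r)
      bound = fromℕ k ^ʳ (1# - r) * S ^ʳ r

      degenerate : S ≈ 0# → Σaʳ ≈ bound
      degenerate S≈0 = begin-equality
        Σaʳ              ≈⟨ sum-const (λ i → 0^ʳ (sum≈0⇒≈0 0≤a S≈0 i) 0<r) ⟩
        fromℕ k * 0#     ≈⟨ zeroʳ _ ⟩
        0#               ≈⟨ zeroʳ _ ⟨
        fromℕ k ^ʳ (1# - r) * 0#  ≈⟨ *-congˡ (0^ʳ S≈0 0<r) ⟨
        bound            ∎

      sum-positive⇒0<k : ∀ {k} (f : Fin k → Carrier) → 0# < sum f → 0# < fromℕ k
      sum-positive⇒0<k {zero}  f 0<0 = 0<0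
      sum-positive⇒0<k {suc k} f _   = 0<fromℕ-suc k

      -- Multiplied by M ^ (1 - r) for the mean M, the claim sums the weighted AM-GM inequalities of a i against M.
      module _ (0<S : 0# < S) where
        K = fromℕ k
        0<K : 0# < K
        0<K = sum-positive⇒0<k a 0<S
        M = S / K
        0<M : 0# < M
        0<M = *-positive 0<S (⁻¹-positive 0<K)
        KM≈S : K * M ≈ S
        KM≈S = trans (solve 3 (λ K S i → K :* (S :* i) := K :* i :* S) refl K S (K ⁻¹))
                 (trans (*-congʳ (⁻¹-inverse 0<K)) (*-identityˡ S))
        N = M ^ʳ (1# - r)
        0<N : 0# < N
        0<N = ^ʳ-positive 0<M (x≤y⇒0≤y-x r≤1)

        Σmeans : sum (λ i → r * a i + (1# - r) * M) ≈ S
        Σmeans = begin-equality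
          sum (λ i → r * a i + (1# - r) * M)   ≈⟨ sum-affine r ((1# - r) * M) a ⟩
          r * S + K * ((1# - r) * M)           ≈⟨ solve 4 (λ r S K M → r :* S :+ K :* ((con (+ 1) :- r) :* M) := r :* S :+ (con (+ 1) :- r) :* (K :* M)) refl r S K M ⟩
          r * S + (1# - r) * (K * M)           ≈⟨ +-congˡ (*-congˡ KM≈S) ⟩
          r * S + (1# - r) * S                 ≈⟨ solve 2 (λ r S → r :* S :+ (con (+ 1) :- r) :* S := S) refl r S ⟩
          S                                    ∎

        N*Σaʳ : sum (λ i → a i ^ʳ r * N) ≈ N * Σaʳ
        N*Σaʳ = trans (sym (*-distribʳ-sum N (λ i → a i ^ʳ r))) (*-comm _ N)

        -- Writing S = K M, the complementary exponents 1 - r and r recombine to K and to M. This is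
        -- what fixes the power 1 - r of k in the bound.
        N*bound : N * bound ≈ S
        N*bound = begin-equality
          N * (K ^ʳ (1# - r) * S ^ʳ r)                  ≈⟨ *-congˡ (*-congˡ (^ʳ-cong 0≤S 0<r (sym KM≈S) refl)) ⟩
          N * (K ^ʳ (1# - r) * (K * M) ^ʳ r)            ≈⟨ *-congˡ (*-congˡ (^ʳ-distrib-* (<⇒≤ 0<K) (<⇒≤ 0<M) 0<r)) ⟩
          N * (K ^ʳ (1# - r) * (K ^ʳ r * M ^ʳ r))       ≈⟨ solve 4 (λ N A B C → N :* (A :* (B :* C)) := A :* B :* (N :* C)) refl N (K ^ʳ (1# - r)) (K ^ʳ r) (M ^ʳ r) ⟩
          K ^ʳ (1# - r) * K ^ʳ r * (N * M ^ʳ r)         ≈⟨ *-cong (^ʳ-conjugate 0<K (<⇒≤ 0<r) r≤1) (^ʳ-conjugate 0<M (<⇒≤ 0<r) r≤1) ⟩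
          K * M                                         ≈⟨ KM≈S ⟩
          S                                             ∎

        am-gm : ∀ i → a i ^ʳ r * N ≤ r * a i + (1# - r) * M
        am-gm i = weighted-am-gm (0≤a i) 0<M 0<r r≤1

        nondegenerate : Σaʳ ≤ bound
        nondegenerate = *-cancelˡ-≤ N 0<N (begin
          N * Σaʳ                                  ≈⟨ N*Σaʳ ⟨
          sum (λ i → a i ^ʳ r * N)                 ≤⟨ sum-mono-≤ am-gm ⟩
          sum (λ i → r * a i + (1# - r) * M)       ≈⟨ Σmeans ⟩
          S                                        ≈⟨ N*bound ⟨
          N * bound                                ∎)

        all≈mean : r < 1# → Σaʳ ≈ bound → ∀ i → a i ≈ M
        all≈mean r<1 eq i = weighted-am-gm-equality (0≤a i) 0<M 0<r r≤1 r<1 (sum-≤-equality am-gm (begin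
          sum (λ i → r * a i + (1# - r) * M)       ≈⟨ Σmeans ⟩
          S                                        ≈⟨ N*bound ⟨
          N * bound                                ≈⟨ *-congˡ eq ⟨
          N * Σaʳ                                  ≈⟨ N*Σaʳ ⟨
          sum (λ i → a i ^ʳ r * N)                 ∎) i)

    power-mean : Σaʳ ≤ bound
    power-mean = [ ≤-reflexive ∘ degenerate , nondegenerate ]′ (0≤⇒≈0⊎0< 0≤S)

    power-mean-equality⇒ : r < 1# → Σaʳ ≈ bound → ∀ i j → a i ≈ a j
    power-mean-equality⇒ r<1 eq i j with 0≤⇒≈0⊎0< 0≤S
    ... | inj₁ S≈0 = trans (sum≈0⇒≈0 0≤a S≈0 i) (sym (sum≈0⇒≈0 0≤a S≈0 j))
    ... | inj₂ 0<S = trans (all≈mean 0<S r<1 eq i) (sym (all≈mean 0<S r<1 eq j))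

  power-mean-equality⇐ : ∀ {k r} (a : Fin k → Carrier) → (∀ i → 0# ≤ a i) → 0# < r → r ≤ 1# → (∀ i j → a i ≈ a j) →
                         sum (λ i → a i ^ʳ r) ≈ fromℕ k ^ʳ (1# - r) * sum a ^ʳ r
  -- With no terms there is no common value to factor out; both sides are 0 because 0 < r.
  power-mean-equality⇐ {zero} a 0≤a 0<r r≤1 a≈ = sym (trans (*-congˡ (0^ʳ refl 0<r)) (zeroʳ _))
  power-mean-equality⇐ {k@(suc _)} {r} a 0≤a 0<r r≤1 a≈ = begin-equality
    sum (λ i → a i ^ʳ r)                        ≈⟨ sum-const (λ i → ^ʳ-cong (0≤a i) 0<r (a≈ i zero) refl) ⟩
    K * α ^ʳ r                                  ≈⟨ *-congʳ (^ʳ-conjugate 0<K (<⇒≤ 0<r) r≤1) ⟨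
    K ^ʳ (1# - r) * K ^ʳ r * α ^ʳ r             ≈⟨ *-assoc _ _ _ ⟩
    K ^ʳ (1# - r) * (K ^ʳ r * α ^ʳ r)           ≈⟨ *-congˡ (^ʳ-distrib-* (<⇒≤ 0<K) (0≤a zero) 0<r) ⟨
    K ^ʳ (1# - r) * (K * α) ^ʳ r                ≈⟨ *-congˡ (^ʳ-cong (sum-nonNegative 0≤a) 0<r (sum-const (λ i → a≈ i zero)) refl) ⟨
    K ^ʳ (1# - r) * sum a ^ʳ r                  ∎
    where
    K = fromℕ k
    α = a zero
    0<K : 0# < K
    0<K = 0<fromℕ {k} ℕ.z<s

  -- Singular values and Schatten norms

  module Schatten {k} (σ : Fin (suc k) → Carrier) (0≤σ : ∀ i → 0# ≤ σ i) {p q} (1≤p : 1# ≤ p) (p≤q : p ≤ q) where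
    private
      0<p : 0# < p
      0<p = 1≤x⇒0<x 1≤p
      0<q : 0# < q
      0<q = begin-strict 0# <⟨ 0<p ⟩ p ≤⟨ p≤q ⟩ q ∎
      0<q⁻¹ = ⁻¹-positive 0<q
      r = p / q
      0<r : 0# < r
      0<r = *-positive 0<p 0<q⁻¹
      qr≈p : q * r ≈ p
      qr≈p = trans (solve 3 (λ q p i → q :* (p :* i) := q :* i :* p) refl q p (q ⁻¹))
               (trans (*-congʳ (⁻¹-inverse 0<q)) (*-identityˡ p))
      r≤1 : r ≤ 1#
      r≤1 = *-cancelˡ-≤ q 0<q (begin
        q * r     ≈⟨ qr≈p ⟩
        p         ≤⟨ p≤q ⟩
        q         ≈⟨ *-identityʳ q ⟨
        q * 1#    ∎)

      a : Fin k → Carrier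
      a i = σ (suc i) ^ʳ q
      0≤a : ∀ i → 0# ≤ a i
      0≤a i = ^ʳ-nonNegative (0≤σ (suc i)) 0<q
      module PM = PowerMean a 0≤a 0<r r≤1

      schattenNorm-^ʳ : ∀ {s} → 0# < s → schattenNorm s σ ^ʳ s ≈ sum (λ i → σ i ^ʳ s)
      schattenNorm-^ʳ {s} 0<s = ^ʳ-inverse (sum-nonNegative λ i → ^ʳ-nonNegative (0≤σ i) 0<s)
        (*-positive 0<1 (⁻¹-positive 0<s)) 0<s
        (trans (*-congʳ (*-identityˡ _)) (trans (*-comm _ _) (⁻¹-inverse 0<s)))

      lhs = schattenNorm p σ ^ʳ p
      coefficient = fromℕ k ^ʳ (1# - r)
      rhs = σ zero ^ʳ p + coefficient * (schattenNorm q σ ^ʳ q - σ zero ^ʳ q) ^ʳ r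
      Σaʳ = sum (λ i → a i ^ʳ r)
      bound = coefficient * sum a ^ʳ r

      lhs≈ : lhs ≈ σ zero ^ʳ p + Σaʳ
      -- As p = q r, each term σ ^ p with index at least 2 is the r-th power of the matching q-th
      -- power.
      lhs≈ = trans (schattenNorm-^ʳ 0<p) (+-congˡ (sum-cong-≋ λ i →
        sym (trans (^ʳ-assocʳ (0≤σ (suc i)) 0<q 0<r) (^ʳ-cong (0≤σ (suc i)) (*-positive 0<q 0<r) refl qr≈p))))

      rhs≈ : rhs ≈ σ zero ^ʳ p + bound
      rhs≈ = +-congˡ (*-congˡ (sym (^ʳ-cong (sum-nonNegative 0≤a) 0<r (begin-equality
        sum a                                          ≈⟨ solve 2 (λ x s → s := x :+ s :- x) refl (σ zero ^ʳ q) (sum a) ⟩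
        σ zero ^ʳ q + sum a - σ zero ^ʳ q              ≈⟨ +-congʳ (schattenNorm-^ʳ 0<q) ⟨
        schattenNorm q σ ^ʳ q - σ zero ^ʳ q            ∎) refl)))

    schatten-≤ : lhs ≤ rhs
    schatten-≤ = begin
      lhs                     ≈⟨ lhs≈ ⟩
      σ zero ^ʳ p + Σaʳ       ≤⟨ +-mono-≤ ≤-refl PM.power-mean ⟩
      σ zero ^ʳ p + bound     ≈⟨ rhs≈ ⟨
      rhs                     ∎

    schatten-equality⇐ : (∀ i j → σ (suc i) ≈ σ (suc j)) → lhs ≈ rhs
    schatten-equality⇐ σ≈ = trans lhs≈ (trans (+-congˡ (power-mean-equality⇐ a 0≤a 0<r r≤1
      λ i j → ^ʳ-cong (0≤σ (suc i)) 0<q (σ≈ i j) refl)) (sym rhs≈))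

    -- For p = q both sides agree whatever σ is, so strictness is what makes equality informative:
    -- it gives r < 1. The power mean then equates the q-th powers, and the exponent 1/q recovers
    -- the singular values.
    schatten-equality⇒ : p < q → lhs ≈ rhs → ∀ i j → σ (suc i) ≈ σ (suc j)
    schatten-equality⇒ p<q eq i j = begin-equality
      σ (suc i)            ≈⟨ ^ʳ-inverse (0≤σ (suc i)) 0<q 0<q⁻¹ (⁻¹-inverse 0<q) ⟨
      a i ^ʳ (q ⁻¹)        ≈⟨ ^ʳ-cong (0≤a i) 0<q⁻¹ (PM.power-mean-equality⇒ r<1 Σaʳ≈bound i j) refl ⟩
      a j ^ʳ (q ⁻¹)        ≈⟨ ^ʳ-inverse (0≤σ (suc j)) 0<q 0<q⁻¹ (⁻¹-inverse 0<q) ⟩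
      σ (suc j)            ∎
      where
      r<1 : r < 1#
      r<1 = r≤1 , λ r≈1 → proj₂ p<q (trans (sym qr≈p) (trans (*-congˡ r≈1) (*-identityʳ q)))
      Σaʳ≈bound : Σaʳ ≈ bound
      Σaʳ≈bound = begin-equality
        Σaʳ                                    ≈⟨ solve 2 (λ x s → s := x :+ s :- x) refl (σ zero ^ʳ p) Σaʳ ⟩
        σ zero ^ʳ p + Σaʳ - σ zero ^ʳ p        ≈⟨ +-congʳ (trans (sym lhs≈) (trans eq rhs≈)) ⟩
        σ zero ^ʳ p + bound - σ zero ^ʳ p      ≈⟨ solve 2 (λ x s → x :+ s :- x := s) refl (σ zero ^ʳ p) bound ⟩
        bound                                  ∎

proposition19 :
  (ℝ : CompleteOrderedField) → let open RealAnalysis ℝ in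
  (m n : ℕ) (1≤m : 1 ℕ.≤ m) → m ℕ.≤ n →
  (A : Matrix Complex m n) (σ : Fin m → Carrier) → AreSingularValues A σ →
  (p q : Carrier) → 1# ≤ p → p ≤ q →
  let σ₁  = σ (fromℕ< 1≤m)
      lhs = schattenNorm p σ ^ʳ p
      rhs = σ₁ ^ʳ p + fromℕ (m ∸ 1) ^ʳ (1# - p / q) * (schattenNorm q σ ^ʳ q - σ₁ ^ʳ q) ^ʳ (p / q)
      σ₂≈⋯≈σₘ = ∀ i j → 1 ℕ.≤ toℕ i → 1 ℕ.≤ toℕ j → σ i ≈ σ j
  in lhs ≤ rhs
     × (σ₂≈⋯≈σₘ → lhs ≈ rhs)
     × (p < q → lhs ≈ rhs → σ₂≈⋯≈σₘ)
proposition19 ℝ (suc k) n _ _ A σ σ-singular p q 1≤p p≤q =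
    schatten-≤
  , (λ σ≈ → schatten-equality⇐ λ i j → σ≈ (suc i) (suc j) ℕ.z<s ℕ.z<s)
  -- Index `zero` is σ₁, so the conditions 1 ≤ `toℕ i` and 1 ≤ `toℕ j` leave exactly the successor
  -- indices.
  , λ { p<q lhs≈rhs (suc i) (suc j) _ _ → schatten-equality⇒ p<q lhs≈rhs i j }
  where
  open RealAnalysis ℝ using (module AreSingularValues)
  open RealPowers.Schatten ℝ σ (AreSingularValues.nonNegative σ-singular) 1≤p p≤q
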